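{- For every $\alpha\ge 1$, the algorithm "partitioning on the pivot closest to the center of the array" is an asymptotically optimal algorithm for LOHification of rank $\alpha$.
   Context: Layer-ordered heap (LOH) of rank $\alpha\ge 1$ on $n$ elements: a partition of an array of $n$ mutually comparable (distinct) values into consecutive layers $L_0\le L_1\le\cdots\le L_{\ell-1}$ (every element of $L_i$ is $\le$ every element of $L_{i+1}$), each layer being internally unordered. With pivots $p_i=\left\lceil\sum_{j=0}^{i}\alpha^j\right\rceil$, the layer sizes are $|L_0|=p_0=1$, $|L_i|=p_i-p_{i-1}$, and the last layer contains the remaining elements beyond the last pivot that is at most $n$. LOHification of rank $\alpha$ is the problem of rearranging an arbitrary array of length $n$ into a LOH of rank $\alpha$, by comparison-based algorithms. Rank $\alpha=1$ is comparison sorting. Runtimes are worst-case and asymptotic as $n\to\infty$. An algorithm is (asymptotically) optimal at rank $\alpha$ if its runtime is within a constant factor, for large $n$, of the best possible runtime of any comparison-based algorithm for LOHification of rank $\alpha$ (where reading the input already costs $\Omega(n)$). Partitioning on the pivot closest to the center of the array: compute the pivots $p_i$; perform a linear-time one-dimensional selection on the pivot closest to the middle index of the current (sub)array and partition the (sub)array about that element; recurse on the two parts; stop on a (sub)array that contains no pivot. Its runtime is $r(0,n)$, where, with $m(n_s,n_e)$ the number of pivots strictly between indices $n_s$ and $n_e$ and $x(n_s,n_e)$ the index of the pivot closest to the middle of the (sub)array from $n_s$ to $n_e$, one has $r(n_s,n_e)=0$ if $n_s\ge n_e$ or $m(n_s,n_e)=0$, and otherwise $r(n_s,n_e)=n_e-n_s+r(n_s,x(n_s,n_e)-1)+r(x(n_s,n_e)+1,n_e)$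 (up to constant factors, and in addition to the $O(n)$ cost of reading the data and computing pivots). -}

module Defs where

open import Data.Bool.Base using (Bool)
open import Data.Fin.Base as Fin using (Fin; fromℕ<)
open import Data.Integer.Base as ℤ using (+_)
import Data.List.Base as List
open import Data.List.Relation.Binary.Permutation.Propositional using (_↭_)
open import Data.Nat.Base as ℕ using (ℕ; zero; suc; _∸_; ∣_-_∣)
open import Data.Nat.Induction using (<-wellFounded)
import Data.Nat.Properties as ℕₚ
open import Data.Product.Base using (∃; ∃-syntax; _×_; _,_; proj₁; proj₂)
open import Data.Rational as ℚ using (ℚ; 0ℚ; 1ℚ; ½; ∣_∣)
import Data.Rational.Properties as ℚₚ
open import Data.Rational.Solver using (module +-*-Solver)
open import Data.Sum.Base using (_⊎_; inj₁; inj₂)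
open import Data.Vec.Base using (Vec; lookup; map; toList; take; drop; init; last; _∷ʳ_; _++_)
  renaming (allFin to positions)
open import Function.Definitions using (Injective)
open import Induction.WellFounded using (Acc; acc)
open import Level using (0ℓ)
open import Relation.Binary.Bundles using (DecTotalOrder)
open import Relation.Binary.PropositionalEquality
  using (_≡_; refl; sym; trans; cong; subst)
open import Relation.Nullary using (¬_; does)

------------------------------------------------------------------------
-- Real numbers: Cauchy sequences of rationals, with pointwise operations.

record ℝ : Set where
  constructor mkℝ
  field
    seq    : ℕ → ℚ
    cauchy : ∀ ε → 0ℚ ℚ.< ε →
             ∃[ N ] ∀ m n → N ℕ.≤ m → N ℕ.≤ n → ∣ seq m ℚ.- seq n ∣ ℚ.≤ ε
open ℝ public

infix  4 _≤ℝ_ _<ℝ_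
infixl 6 _+ℝ_
infixl 7 _*ℝ_
infixr 8 _^ℝ_

_≤ℝ_ : ℝ → ℝ → Set
x ≤ℝ y = ∀ ε → 0ℚ ℚ.< ε → ∃[ N ] ∀ n → N ℕ.≤ n → seq x n ℚ.≤ seq y n ℚ.+ ε

_<ℝ_ : ℝ → ℝ → Set
x <ℝ y = ∃[ ε ] 0ℚ ℚ.< ε × ∃[ N ] ∀ n → N ℕ.≤ n → seq x n ℚ.+ ε ℚ.≤ seq y n

fromℚ : ℚ → ℝ
fromℚ q = mkℝ (λ _ → q) λ ε 0<ε → 0 , λ _ _ _ _ →
  ℚₚ.≤-trans (ℚₚ.≤-reflexive (cong ∣_∣ (ℚₚ.+-inverseʳ q))) (ℚₚ.<⇒≤ 0<ε)

fromℕ : ℕ → ℝ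
fromℕ k = fromℚ (+ k ℚ./ 1)

1ℝ : ℝ
1ℝ = fromℕ 1

_+ℝ_ : ℝ → ℝ → ℝ
seq    (x +ℝ y) n = seq x n ℚ.+ seq y n
cauchy (x +ℝ y) ε 0<ε = N ℕ.⊔ M , bound
  where
  ε/2 = ½ ℚ.* ε
  0<ε/2 : 0ℚ ℚ.< ε/2
  0<ε/2 = ℚₚ.positive⁻¹ ε/2 {{ℚₚ.pos*pos⇒pos ½ ε {{ℚ.positive 0<ε}}}}
  N = proj₁ (cauchy x ε/2 0<ε/2)
  M = proj₁ (cauchy y ε/2 0<ε/2)
  halves : ε/2 ℚ.+ ε/2 ≡ ε
  halves = trans (sym (ℚₚ.*-distribʳ-+ ε ½ ½)) (ℚₚ.*-identityˡ ε)
  regroup : ∀ a b c d → (a ℚ.+ b) ℚ.- (c ℚ.+ d) ≡ (a ℚ.- c) ℚ.+ (b ℚ.- d)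
  regroup = solve 4 (λ a b c d → (a :+ b) :- (c :+ d) := (a :- c) :+ (b :- d)) refl
    where open +-*-Solver
  bound : ∀ m n → N ℕ.⊔ M ℕ.≤ m → N ℕ.⊔ M ℕ.≤ n →
          ∣ (seq x m ℚ.+ seq y m) ℚ.- (seq x n ℚ.+ seq y n) ∣ ℚ.≤ ε
  bound m n ≤m ≤n = begin
    ∣ (seq x m ℚ.+ seq y m) ℚ.- (seq x n ℚ.+ seq y n) ∣
      ≡⟨ cong ∣_∣ (regroup (seq x m) (seq y m) (seq x n) (seq y n)) ⟩
    ∣ (seq x m ℚ.- seq x n) ℚ.+ (seq y m ℚ.- seq y n) ∣
      ≤⟨ ℚₚ.∣p+q∣≤∣p∣+∣q∣ (seq x m ℚ.- seq x n) (seq y m ℚ.- seq y n) ⟩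
    ∣ seq x m ℚ.- seq x n ∣ ℚ.+ ∣ seq y m ℚ.- seq y n ∣
      ≤⟨ ℚₚ.+-mono-≤
           (proj₂ (cauchy x ε/2 0<ε/2) m n (ℕₚ.m⊔n≤o⇒m≤o N M ≤m) (ℕₚ.m⊔n≤o⇒m≤o N M ≤n))
           (proj₂ (cauchy y ε/2 0<ε/2) m n (ℕₚ.m⊔n≤o⇒n≤o N M ≤m) (ℕₚ.m⊔n≤o⇒n≤o N M ≤n)) ⟩
    ε/2 ℚ.+ ε/2 ≡⟨ halves ⟩
    ε ∎
    where open ℚₚ.≤-Reasoning

private
  0<1 : 0ℚ ℚ.< 1ℚ
  0<1 = ℚₚ.positive⁻¹ 1ℚ

  threshold : ℝ → ℕ
  threshold x = proj₁ (cauchy x 1ℚ 0<1)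

  size : ℝ → ℚ
  size x = 1ℚ ℚ.+ ∣ seq x (threshold x) ∣

  size-pos : ∀ x → ℚ.Positive (size x)
  size-pos x = ℚ.positive (ℚₚ.+-mono-<-≤ 0<1 (ℚₚ.0≤∣p∣ (seq x (threshold x))))

  eventually-bounded : ∀ x n → threshold x ℕ.≤ n → ∣ seq x n ∣ ℚ.≤ size x
  eventually-bounded x n ≤n = begin
    ∣ seq x n ∣
      ≡⟨ cong ∣_∣ (telescope (seq x n) (seq x (threshold x))) ⟩
    ∣ (seq x n ℚ.- seq x (threshold x)) ℚ.+ seq x (threshold x) ∣
      ≤⟨ ℚₚ.∣p+q∣≤∣p∣+∣q∣ (seq x n ℚ.- seq x (threshold x)) (seq x (threshold x)) ⟩
    ∣ seq x n ℚ.- seq x (threshold x) ∣ ℚ.+ ∣ seq x (threshold x) ∣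
      ≤⟨ ℚₚ.+-monoˡ-≤ ∣ seq x (threshold x) ∣
           (proj₂ (cauchy x 1ℚ 0<1) n (threshold x) ≤n ℕₚ.≤-refl) ⟩
    size x ∎
    where
    open ℚₚ.≤-Reasoning
    telescope : ∀ a b → a ≡ (a ℚ.- b) ℚ.+ b
    telescope = solve 2 (λ a b → a := (a :- b) :+ b) refl
      where open +-*-Solver

_*ℝ_ : ℝ → ℝ → ℝ
seq    (x *ℝ y) n = seq x n ℚ.* seq y n
cauchy (x *ℝ y) ε 0<ε = N₀ , bound
  where
  A = size x
  B = size y
  instance
    A-pos : ℚ.Positive A
    A-pos = size-pos x
    B-pos : ℚ.Positive B
    B-pos = size-pos y
    A+B-pos : ℚ.Positive (A ℚ.+ B)
    A+B-pos = ℚₚ.pos+pos⇒pos A B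
    A+B-nonZero : ℚ.NonZero (A ℚ.+ B)
    A+B-nonZero = ℚₚ.pos⇒nonZero (A ℚ.+ B)
    ε-pos : ℚ.Positive ε
    ε-pos = ℚ.positive 0<ε
  δ = ε ℚ.* (ℚ.1/ (A ℚ.+ B))
  δ-pos : ℚ.Positive δ
  δ-pos = ℚₚ.pos*pos⇒pos ε (ℚ.1/ (A ℚ.+ B)) {{ℚₚ.1/pos⇒pos (A ℚ.+ B)}}
  0<δ : 0ℚ ℚ.< δ
  0<δ = ℚₚ.positive⁻¹ δ {{δ-pos}}
  δ-split : A ℚ.* δ ℚ.+ δ ℚ.* B ≡ ε
  δ-split = trans (regroup A B ε (ℚ.1/ (A ℚ.+ B)))
            (trans (cong (ε ℚ.*_) (ℚₚ.*-inverseˡ (A ℚ.+ B))) (ℚₚ.*-identityʳ ε))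
    where
    regroup : ∀ a b e i → a ℚ.* (e ℚ.* i) ℚ.+ e ℚ.* i ℚ.* b ≡ e ℚ.* (i ℚ.* (a ℚ.+ b))
    regroup = solve 4 (λ a b e i → a :* (e :* i) :+ e :* i :* b := e :* (i :* (a :+ b))) refl
      where open +-*-Solver
  N = proj₁ (cauchy x δ 0<δ)
  M = proj₁ (cauchy y δ 0<δ)
  N₁ = N ℕ.⊔ threshold x
  M₁ = M ℕ.⊔ threshold y
  N₀ = N₁ ℕ.⊔ M₁
  regroup : ∀ a b c d → (a ℚ.* b) ℚ.- (c ℚ.* d) ≡ a ℚ.* (b ℚ.- d) ℚ.+ (a ℚ.- c) ℚ.* d
  regroup = solve 4 (λ a b c d → (a :* b) :- (c :* d) := a :* (b :- d) :+ (a :- c) :* d) refl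
    where open +-*-Solver
  product-bound : ∀ a b {r s} → ℚ.NonNegative r → ∣ a ∣ ℚ.≤ r → ∣ b ∣ ℚ.≤ s →
                  ∣ a ℚ.* b ∣ ℚ.≤ r ℚ.* s
  product-bound a b {r} {s} r≥0 a≤r b≤s = begin
    ∣ a ℚ.* b ∣       ≡⟨ ℚₚ.∣p*q∣≡∣p∣*∣q∣ a b ⟩
    ∣ a ∣ ℚ.* ∣ b ∣   ≤⟨ ℚₚ.*-monoʳ-≤-nonNeg ∣ b ∣ {{ℚ.nonNegative (ℚₚ.0≤∣p∣ b)}} a≤r ⟩
    r ℚ.* ∣ b ∣       ≤⟨ ℚₚ.*-monoˡ-≤-nonNeg r {{r≥0}} b≤s ⟩
    r ℚ.* s           ∎
    where open ℚₚ.≤-Reasoning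
  bound : ∀ m n → N₀ ℕ.≤ m → N₀ ℕ.≤ n →
          ∣ (seq x m ℚ.* seq y m) ℚ.- (seq x n ℚ.* seq y n) ∣ ℚ.≤ ε
  bound m n ≤m ≤n = begin
    ∣ (seq x m ℚ.* seq y m) ℚ.- (seq x n ℚ.* seq y n) ∣
      ≡⟨ cong ∣_∣ (regroup (seq x m) (seq y m) (seq x n) (seq y n)) ⟩
    ∣ seq x m ℚ.* (seq y m ℚ.- seq y n) ℚ.+ (seq x m ℚ.- seq x n) ℚ.* seq y n ∣
      ≤⟨ ℚₚ.∣p+q∣≤∣p∣+∣q∣ (seq x m ℚ.* (seq y m ℚ.- seq y n))
                           ((seq x m ℚ.- seq x n) ℚ.* seq y n) ⟩
    ∣ seq x m ℚ.* (seq y m ℚ.- seq y n) ∣ ℚ.+ ∣ (seq x m ℚ.- seq x n) ℚ.* seq y n ∣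
      ≤⟨ ℚₚ.+-mono-≤
           (product-bound (seq x m) (seq y m ℚ.- seq y n) (ℚₚ.pos⇒nonNeg A)
             (eventually-bounded x m (ℕₚ.m⊔n≤o⇒n≤o N (threshold x) (ℕₚ.m⊔n≤o⇒m≤o N₁ M₁ ≤m)))
             (proj₂ (cauchy y δ 0<δ) m n (≥M ≤m) (≥M ≤n)))
           (product-bound (seq x m ℚ.- seq x n) (seq y n) (ℚₚ.pos⇒nonNeg δ {{δ-pos}})
             (proj₂ (cauchy x δ 0<δ) m n (≥N ≤m) (≥N ≤n))
             (eventually-bounded y n (ℕₚ.m⊔n≤o⇒n≤o M (threshold y) (ℕₚ.m⊔n≤o⇒n≤o N₁ M₁ ≤n)))) ⟩
    A ℚ.* δ ℚ.+ δ ℚ.* B ≡⟨ δ-split ⟩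
    ε ∎
    where
    open ℚₚ.≤-Reasoning
    ≥N : ∀ {k} → N₀ ℕ.≤ k → N ℕ.≤ k
    ≥N h = ℕₚ.m⊔n≤o⇒m≤o N (threshold x) (ℕₚ.m⊔n≤o⇒m≤o N₁ M₁ h)
    ≥M : ∀ {k} → N₀ ℕ.≤ k → M ℕ.≤ k
    ≥M h = ℕₚ.m⊔n≤o⇒m≤o M (threshold y) (ℕₚ.m⊔n≤o⇒n≤o N₁ M₁ h)

_^ℝ_ : ℝ → ℕ → ℝ
x ^ℝ zero  = 1ℝ
x ^ℝ suc j = x *ℝ x ^ℝ j

------------------------------------------------------------------------

powerSum : ℝ → ℕ → ℝ
powerSum α zero    = α ^ℝ 0
powerSum α (suc i) = powerSum α i +ℝ α ^ℝ suc i

-- k = ⌈ x ⌉, as a relation: the ceiling of a real is not computable.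
IsCeiling : ℝ → ℕ → Set
IsCeiling x k = x ≤ℝ fromℕ k × fromℕ k <ℝ x +ℝ 1ℝ

ArePivots : ℝ → (ℕ → ℕ) → Set
ArePivots α p = ∀ i → IsCeiling (powerSum α i) (p i)

layerStart : (ℕ → ℕ) → ℕ → ℕ
layerStart p zero    = 0
layerStart p (suc i) = p i

-- With array indices counted from 0, L_i occupies the indices
-- p_{i-1} ≤ k < p_i (where p_{-1} = 0).  In an array of length n only indices
-- below n occur, so the last nonempty layer is whatever remains after the
-- last pivot.
InLayer : (ℕ → ℕ) → ℕ → ∀ {n} → Fin n → Set
InLayer p i k = layerStart p i ℕ.≤ Fin.toℕ k × Fin.toℕ k ℕ.< p i

------------------------------------------------------------------------

-- X is the type of handles to the elements being compared; a computation
-- learns about the elements only through the answers to its comparisons.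
-- `step` is a unit of work other than a comparison.
data Comp (X R : Set) : Set where
  return  : R → Comp X R
  step    : Comp X R → Comp X R
  compare : X → X → (Bool → Comp X R) → Comp X R

private
  variable
    X Y R S : Set
    m n : ℕ

infixl 1 _>>=_
_>>=_ : Comp X R → (R → Comp X S) → Comp X S
return r      >>= f = f r
step t        >>= f = step (t >>= f)
compare x y k >>= f = compare x y λ b → k b >>= f

rename : (X → Y) → Comp X R → Comp Y R
rename h (return r)      = return r
rename h (step t)        = step (rename h t)
rename h (compare x y k) = compare (h x) (h y) λ b → rename h (k b)

steps : ℕ → Comp X R → Comp X R
steps zero    t = t
steps (suc k) t = step (steps k t)

module _ (answer : X → X → Bool) where

  result : Comp X R → R
  result (return r)      = r
  result (step t)        = result t
  result (compare x y k) = result (k (answer x y))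

  cost : Comp X R → ℕ
  cost (return r)      = 0
  cost (step t)        = suc (cost t)
  cost (compare x y k) = suc (cost (k (answer x y)))

record Input (n : ℕ) : Set₁ where
  field
    order    : DecTotalOrder 0ℓ 0ℓ 0ℓ
  open DecTotalOrder order public using (Carrier; _≈_; _≤_; _≤?_)
  field
    value    : Fin n → Carrier
    distinct : Injective _≡_ _≈_ value

  answer : Fin n → Fin n → Bool
  answer i j = does (value i ≤? value j)

-- The k-th entry of the output is the original position of the element that
-- is moved to position k.
Algorithm : ℕ → Set
Algorithm n = Comp (Fin n) (Vec (Fin n) n)

module _ (I : Input n) where
  open Input I

  output : Algorithm n → Vec (Fin n) n
  output t = result answer t

  outputValue : Algorithm n → Fin n → Carrier
  outputValue t k = value (lookup (output t) k)

  Rearranges : Algorithm n → Set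
  Rearranges t = toList (output t) ↭ List.allFin n

LOHifies : (ℕ → ℕ) → Algorithm n → Set₁
LOHifies {n} p t = ∀ (I : Input n) → let open Input I in
  Rearranges I t ×
  (∀ i (k l : Fin n) → InLayer p i k → InLayer p (suc i) l →
     outputValue I t k ≤ outputValue I t l)

-- Worst-case runtime at most B; the summand n is the reading of the input.
RunsWithin : Algorithm n → ℕ → Set₁
RunsWithin {n} t B = ∀ (I : Input n) → n ℕ.+ cost (Input.answer I) t ℕ.≤ B

-- T n is within a constant factor, for large n, of the runtime of every
-- LOHification algorithm for length n, hence of the best possible one.
OptimalRuntime : (ℕ → ℕ) → (ℕ → ℕ) → Set₁
OptimalRuntime p T = ∃[ C ] ∃[ N ] ∀ n → N ℕ.≤ n →
  ∀ (t : Algorithm n) → LOHifies p t → ∀ B → RunsWithin t B → T n ℕ.≤ C ℕ.* B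

AsymptoticallyOptimal : (ℕ → ℕ) → (∀ n → Algorithm n) → Set₁
AsymptoticallyOptimal p alg =
  (∀ n → LOHifies p (alg n)) ×
  (∃[ C ] ∃[ N ] ∀ n → N ℕ.≤ n →
     ∀ (t : Algorithm n) → LOHifies p t → ∀ B → RunsWithin t B →
     RunsWithin (alg n) (C ℕ.* B))

------------------------------------------------------------------------

-- Linear-time one-dimensional selection, including the partitioning of the
-- array about the selected element.

Selects : Fin m → Algorithm m → Set₁
Selects {m} k t = ∀ (I : Input m) → let open Input I in
  Rearranges I t ×
  (∀ i → i Fin.< k → outputValue I t i ≤ outputValue I t k) ×
  (∀ i → k Fin.< i → outputValue I t k ≤ outputValue I t i)

record LinearSelection : Set₁ where
  field
    select   : ∀ m → Fin m → Algorithm m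
    selects  : ∀ m k → Selects k (select m k)
    constant : ℕ
    linear   : ∀ m k → RunsWithin (select m k) (constant ℕ.* m)

------------------------------------------------------------------------

PivotBetween : (ℕ → ℕ) → ℕ → ℕ → ℕ → Set
PivotBetween p ns ne x = (∃[ i ] p i ≡ x) × ns ℕ.< x × x ℕ.< ne

-- Distances to the middle (ns + ne) / 2 are doubled to stay within ℕ.
ClosestPivot : (ℕ → ℕ) → ℕ → ℕ → ℕ → Set
ClosestPivot p ns ne x =
  PivotBetween p ns ne x ×
  (∀ y → PivotBetween p ns ne y →
     ∣ 2 ℕ.* x - (ns ℕ.+ ne) ∣ ℕ.≤ ∣ 2 ℕ.* y - (ns ℕ.+ ne) ∣)

-- A way of finding the closest pivot, with ties broken arbitrarily.  One
-- exists for every strictly increasing p, by bounded search.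
CenterRule : (ℕ → ℕ) → Set
CenterRule p = ∀ ns ne →
  ∃ (ClosestPivot p ns ne) ⊎ (∀ x → ¬ PivotBetween p ns ne x)

module _ {p : ℕ → ℕ} (rule : CenterRule p) where

  -- If ns ≥ ne then no pivot lies strictly between, so that case of the
  -- recurrence is covered by the first clause.
  recurrence : ∀ ns ne → Acc ℕ._<_ (ne ∸ ns) → ℕ
  recurrence ns ne (acc rec) with rule ns ne
  ... | inj₂ _ = 0
  ... | inj₁ (x , (_ , ns<x , x<ne) , _) =
    (ne ∸ ns) ℕ.+ recurrence ns (x ∸ 1) (rec left<) ℕ.+ recurrence (suc x) ne (rec right<)
    where
    left< : (x ∸ 1) ∸ ns ℕ.< ne ∸ ns
    left< = ℕₚ.≤-<-trans (ℕₚ.∸-monoˡ-≤ ns (ℕₚ.m∸n≤m x 1)) (ℕₚ.∸-monoˡ-< x<ne (ℕₚ.<⇒≤ ns<x))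
    right< : ne ∸ suc x ℕ.< ne ∸ ns
    right< = ℕₚ.∸-monoʳ-< (ℕₚ.m≤n⇒m≤1+n ns<x) x<ne

  r : ℕ → ℕ → ℕ
  r ns ne = recurrence ns ne (<-wellFounded (ne ∸ ns))

  module _ (sel : LinearSelection) where
    open LinearSelection sel

    selectIn : Fin m → Vec X m → Comp X (Vec X m)
    selectIn {m = m} k xs =
      rename (lookup xs) (select m k) >>= λ order → return (map (lookup xs) order)

    -- xs holds the elements at the indices ns, …, ns + m - 1 of the array, so
    -- the left part ends (exclusively) at x.  The recurrence for r ends it at
    -- x - 1 and thereby ignores a pivot equal to x - 1, which must not be
    -- skipped here.
    partition : ∀ ns → Vec X m → Acc ℕ._<_ m → Comp X (Vec X m)
    partition {m = m} ns xs (acc rec) with rule ns (ns ℕ.+ m)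
    ... | inj₂ _ = return xs
    ... | inj₁ (x , (_ , ns<x , x<ne) , _)
        with k<m ← subst (x ∸ ns ℕ.<_) (ℕₚ.m+n∸m≡n ns m) (ℕₚ.∸-monoˡ-< x<ne (ℕₚ.<⇒≤ ns<x))
        with j , refl ← ℕₚ.m≤n⇒∃[o]m+o≡n k<m =
      selectIn (fromℕ< k<m) xs >>= λ ys →
      partition ns (init (take (suc k) ys)) (rec k<m) >>= λ left →
      partition (suc x) (drop (suc k) ys) (rec (ℕₚ.m<n+m j ℕ.z<s)) >>= λ right →
      return ((left ∷ʳ last (take (suc k) ys)) ++ right)
      where k = x ∸ ns

    -- The n initial steps pay for the computation of the pivots.
    centerPartitioning : ∀ n → Algorithm n
    centerPartitioning n = steps n (partition 0 (positions n) (<-wellFounded n))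

module Submission where

-- The rank enters only through the pivots being strictly increasing, which
-- makes every pivot a point that any LOHification has to separate.
--
-- Upper bound.  If the pivot closest to the center splits m elements into a
-- and b, then m = 2 (a ⊓ b) + ∣ a - b ∣, and beside that pivot there is a
-- pivot-free gap of length ∣ a - b ∣.  Every gap is charged at most once from
-- each side, so the sizes of all segments sum to at most 2 K + 2 n, where K is
-- the sum of a ⊓ b over all splits.
--
-- Lower bound.  At each split, a ⊓ b pairs of elements, one from each side, may
-- be exchanged independently.  This gives 2 ^ K inputs no two of which admit
-- the same output, so some input requires at least K comparisons.

open import Data.Bool.Base using (Bool; true; false)
import Data.Bool.Properties as Bool
open import Data.Fin.Base using (Fin; zero; suc; toℕ; fromℕ<)
import Data.Fin.Properties as Fin
import Data.Integer.Base as ℤ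
import Data.Integer.Properties as ℤₚ
open import Data.List.Base as List using (List; []; _∷_; _++_; length; filter)
import Data.List.Properties as List
open import Data.List.Membership.Propositional using (_∈_; lose)
open import Data.List.Membership.Propositional.Properties using (∈-allFin; ∈-filter⁻; ∈-map⁻)
open import Data.List.Relation.Binary.Permutation.Propositional
  using (_↭_; ↭-refl; ↭-sym; ↭-trans; ↭-reflexive; prep; ↭⇒↭ₛ; module PermutationReasoning)
open import Data.List.Relation.Binary.Permutation.Propositional.Properties
  using (shift; map⁺; ++⁺; ++-comm; ↭-length; All-resp-↭; filter-↭)
import Data.List.Relation.Binary.Permutation.Setoid.Properties as ↭ₛ
open import Data.List.Relation.Binary.Pointwise as Pointwise using (Pointwise; []; _∷_)
open import Data.List.Relation.Unary.All as All using (All; []; _∷_)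
import Data.List.Relation.Unary.All.Properties as All
open import Data.List.Relation.Unary.AllPairs using ([]; _∷_)
open import Data.List.Relation.Unary.Any using (here; there)
open import Data.List.Relation.Unary.Unique.Propositional using (Unique)
import Data.List.Relation.Unary.Unique.Propositional.Properties as Unique
open import Data.Nat.Base as ℕ
open import Data.Nat.Coprimality using (1-coprimeTo) renaming (sym to coprime-sym)
open import Data.Nat.Induction using (<-wellFounded)
open import Data.Nat.Properties as ℕₚ
import Data.Nat.Solver as ℕ-Solver
open import Data.Product.Base using (_,_; proj₁; proj₂; _×_; ∃-syntax; Σ)
open import Data.Rational as ℚ using (ℚ; 0ℚ; 1ℚ; ½)
import Data.Rational.Properties as ℚₚ
import Data.Rational.Solver as ℚ-Solver
open import Data.Sum.Base using (inj₁; inj₂)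
open import Data.Vec.Base as Vec using (Vec; []; _∷_; lookup; toList; _∷ʳ_)
import Data.Vec.Properties as Vec
open import Function.Base using (_∘_; case_of_; id)
open import Induction.WellFounded using (Acc; acc)
open import Relation.Binary.Bundles using (DecTotalOrder)
open import Relation.Binary.Definitions using (tri<; tri≈; tri>)
open import Relation.Binary.PropositionalEquality
open import Relation.Nullary using (¬_; contradiction; yes; no)
open import Relation.Unary using (Decidable; Pred)
open import Relation.Unary.Properties using (∁?)
open import Defs

-- Neither K nor the total size is ever estimated as a function of n, although their growth differs
-- with the rank. A tree of splits with K exchanges has total size at most 2 (K + n), while every
-- LOHification runs for at least n + K, so the factor 2 comes out for every rank alike. The
-- exchanges give exactly 2 ^ K inputs, which avoids logarithms of factorials of the layer sizes.
-- The algorithm and the recurrence for r do not cut in the same places, since r also drops the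
-- index before the pivot. Both are instances of one type of trees with a parameter e; their values
-- of K may differ, but each is compared with the runtime on its own. The charging argument does not
-- survive recursion as it stands: a gap opened by one split is shortened by later ones. The
-- induction therefore bounds the total size together with the pivot-free ends of the segment.

private variable
  X : Set
  k m s x : ℕ

-- Growth of the pivots

p≤p+q : ∀ p {q} → 0ℚ ℚ.≤ q → p ℚ.≤ p ℚ.+ q
p≤p+q p {q} 0≤q = subst (ℚ._≤ p ℚ.+ q) (ℚₚ.+-identityʳ p) (ℚₚ.+-monoʳ-≤ p 0≤q)

0<½* : ∀ {ε} → 0ℚ ℚ.< ε → 0ℚ ℚ.< ½ ℚ.* ε
0<½* {ε} 0<ε = ℚₚ.positive⁻¹ (½ ℚ.* ε) {{ℚₚ.pos*pos⇒pos ½ ε {{ℚ.positive 0<ε}}}}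

½*+½* : ∀ ε → ½ ℚ.* ε ℚ.+ ½ ℚ.* ε ≡ ε
½*+½* ε = trans (sym (ℚₚ.*-distribʳ-+ ε ½ ½)) (ℚₚ.*-identityˡ ε)

0<⊓ : ∀ {a b} → 0ℚ ℚ.< a → 0ℚ ℚ.< b → 0ℚ ℚ.< a ℚ.⊓ b
0<⊓ {a} {b} 0<a 0<b with ℚₚ.⊓-sel a b
... | inj₁ eq = subst (0ℚ ℚ.<_) (sym eq) 0<a
... | inj₂ eq = subst (0ℚ ℚ.<_) (sym eq) 0<b

-- (1 - δ)² ≥ 1 - 2 δ, so a product doubles the defect at most. The bound `δ ℚ.≤ 1ℚ` keeps the
-- factors nonnegative, as monotonicity of multiplication requires.
1≤* : ∀ x y {δ} → 0ℚ ℚ.≤ δ → δ ℚ.≤ 1ℚ → 1ℚ ℚ.≤ x ℚ.+ δ → 1ℚ ℚ.≤ y ℚ.+ δ →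
      1ℚ ℚ.≤ x ℚ.* y ℚ.+ (δ ℚ.+ δ)
1≤* x y {δ} 0≤δ δ≤1 1≤x+δ 1≤y+δ = begin
  1ℚ                                         ≤⟨ p≤p+q 1ℚ (ℚₚ.nonNegative⁻¹ (δ ℚ.* δ) {{ℚₚ.nonNeg*nonNeg⇒nonNeg δ {{nnδ}} δ {{nnδ}}}}) ⟩
  1ℚ ℚ.+ δ ℚ.* δ                             ≡⟨ expand δ ⟩
  (1ℚ ℚ.- δ) ℚ.* (1ℚ ℚ.- δ) ℚ.+ (δ ℚ.+ δ)   ≤⟨ ℚₚ.+-monoˡ-≤ (δ ℚ.+ δ) (ℚₚ.*-monoˡ-≤-nonNeg (1ℚ ℚ.- δ) {{nn1-δ}} (move y 1≤y+δ)) ⟩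
  (1ℚ ℚ.- δ) ℚ.* y ℚ.+ (δ ℚ.+ δ)             ≤⟨ ℚₚ.+-monoˡ-≤ (δ ℚ.+ δ) (ℚₚ.*-monoʳ-≤-nonNeg y {{nny}} (move x 1≤x+δ)) ⟩
  x ℚ.* y ℚ.+ (δ ℚ.+ δ)                      ∎
  where
  open ℚₚ.≤-Reasoning
  open ℚ-Solver.+-*-Solver
  expand : ∀ d → 1ℚ ℚ.+ d ℚ.* d ≡ (1ℚ ℚ.- d) ℚ.* (1ℚ ℚ.- d) ℚ.+ (d ℚ.+ d)
  expand = solve 1 (λ d → con 1ℚ :+ d :* d := (con 1ℚ :- d) :* (con 1ℚ :- d) :+ (d :+ d)) refl
  cancel : ∀ d z → (z ℚ.+ d) ℚ.- d ≡ z
  cancel = solve 2 (λ d z → (z :+ d) :- d := z) refl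
  move : ∀ z → 1ℚ ℚ.≤ z ℚ.+ δ → 1ℚ ℚ.- δ ℚ.≤ z
  move z h = ℚₚ.≤-trans (ℚₚ.+-monoˡ-≤ (ℚ.- δ) h) (ℚₚ.≤-reflexive (cancel δ z))
  nnδ : ℚ.NonNegative δ
  nnδ = ℚ.nonNegative 0≤δ
  0≤1-δ : 0ℚ ℚ.≤ 1ℚ ℚ.- δ
  0≤1-δ = subst (ℚ._≤ 1ℚ ℚ.- δ) (ℚₚ.+-inverseʳ δ) (ℚₚ.+-monoˡ-≤ (ℚ.- δ) δ≤1)
  nn1-δ : ℚ.NonNegative (1ℚ ℚ.- δ)
  nn1-δ = ℚ.nonNegative 0≤1-δ
  nny : ℚ.NonNegative y
  nny = ℚ.nonNegative (ℚₚ.≤-trans 0≤1-δ (move y 1≤y+δ))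

1≤ℝ^ : ∀ α → 1ℝ ≤ℝ α → ∀ j → 1ℝ ≤ℝ α ^ℝ j
1≤ℝ^ α 1≤α zero    ε 0<ε = 0 , λ _ _ → p≤p+q 1ℚ (ℚₚ.<⇒≤ 0<ε)
1≤ℝ^ α 1≤α (suc j) ε 0<ε = N ℕ.⊔ M , λ n N⊔M≤n → ℚₚ.≤-trans
    (1≤* (seq α n) (seq (α ^ℝ j) n) (ℚₚ.<⇒≤ 0<δ) (ℚₚ.p⊓q≤q (½ ℚ.* ε) 1ℚ)
      (proj₂ (1≤α δ 0<δ) n (ℕₚ.m⊔n≤o⇒m≤o N M N⊔M≤n))
      (proj₂ (1≤ℝ^ α 1≤α j δ 0<δ) n (ℕₚ.m⊔n≤o⇒n≤o N M N⊔M≤n)))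
    (ℚₚ.+-monoʳ-≤ (seq α n ℚ.* seq (α ^ℝ j) n) δ+δ≤ε)
  where
  -- The half makes δ + δ fit into ε; the cap at 1 meets the hypothesis of `1≤*`.
  δ = (½ ℚ.* ε) ℚ.⊓ 1ℚ
  0<δ : 0ℚ ℚ.< δ
  0<δ = 0<⊓ (0<½* 0<ε) (ℚₚ.positive⁻¹ 1ℚ)
  N = proj₁ (1≤α δ 0<δ)
  M = proj₁ (1≤ℝ^ α 1≤α j δ 0<δ)
  δ+δ≤ε : δ ℚ.+ δ ℚ.≤ ε
  δ+δ≤ε = ℚₚ.≤-trans (ℚₚ.+-mono-≤ (ℚₚ.p⊓q≤p (½ ℚ.* ε) 1ℚ) (ℚₚ.p⊓q≤p (½ ℚ.* ε) 1ℚ))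
    (ℚₚ.≤-reflexive (½*+½* ε))

/1-mono-≤ : ∀ {a b} → a ℕ.≤ b → ℤ.+ a ℚ./ 1 ℚ.≤ ℤ.+ b ℚ./ 1
/1-mono-≤ {a} {b} a≤b = subst₂ ℚ._≤_ (sym (/1-normal a)) (sym (/1-normal b))
  (ℚ.*≤* (ℤₚ.*-monoʳ-≤-nonNeg (ℤ.+ 1) (ℤ.+≤+ a≤b)))
  where
  /1-normal : ∀ k → ℤ.+ k ℚ./ 1 ≡ ℚ.mkℚ (ℤ.+ k) 0 _
  /1-normal k = ℚₚ.normalize-coprime (coprime-sym (1-coprimeTo k))

-- The margin e of the strict ceiling inequality is divided: one half h remains as the strict gap
-- between q and q′, the other pays for two approximation errors δ.
<-from-halves : ∀ q q′ σ a {e h δ} → 0ℚ ℚ.< h → h ℚ.+ h ≡ e → δ ℚ.+ δ ≡ h →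
  q ℚ.+ e ℚ.≤ σ ℚ.+ 1ℚ → 1ℚ ℚ.≤ a ℚ.+ δ → σ ℚ.+ a ℚ.≤ q′ ℚ.+ δ → q ℚ.< q′
<-from-halves q q′ σ a {h = h} {δ} 0<h refl refl q+e≤σ+1 1≤a+δ σ+a≤q′+δ = begin-strict
  q                              <⟨ p<p+q ⟩
  q ℚ.+ h                        ≡⟨ cancel q h ⟩
  (q ℚ.+ (h ℚ.+ h)) ℚ.- h        ≤⟨ ℚₚ.+-monoˡ-≤ (ℚ.- h) q+e≤σ+1 ⟩
  (σ ℚ.+ 1ℚ) ℚ.- h               ≤⟨ ℚₚ.+-monoˡ-≤ (ℚ.- h) (ℚₚ.+-monoʳ-≤ σ 1≤a+δ) ⟩
  (σ ℚ.+ (a ℚ.+ δ)) ℚ.- h        ≡⟨ cong (ℚ._- h) (ℚₚ.+-assoc σ a δ) ⟨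
  (σ ℚ.+ a ℚ.+ δ) ℚ.- h          ≤⟨ ℚₚ.+-monoˡ-≤ (ℚ.- h) (ℚₚ.+-monoˡ-≤ δ σ+a≤q′+δ) ⟩
  (q′ ℚ.+ δ ℚ.+ δ) ℚ.- h         ≡⟨ cancel′ q′ δ ⟩
  q′                             ∎
  where
  open ℚₚ.≤-Reasoning
  open ℚ-Solver.+-*-Solver
  p<p+q : q ℚ.< q ℚ.+ h
  p<p+q = subst (ℚ._< q ℚ.+ h) (ℚₚ.+-identityʳ q) (ℚₚ.+-monoʳ-< q 0<h)
  cancel : ∀ q h → q ℚ.+ h ≡ (q ℚ.+ (h ℚ.+ h)) ℚ.- h
  cancel = solve 2 (λ q h → q :+ h := (q :+ (h :+ h)) :- h) refl
  cancel′ : ∀ q d → (q ℚ.+ d ℚ.+ d) ℚ.- (d ℚ.+ d) ≡ q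
  cancel′ = solve 2 (λ q d → (q :+ d :+ d) :- (d :+ d) := q) refl

-- With S i the i-th power sum, p i < S i + 1 ≤ S i + α ^ (i + 1) = S (i + 1) ≤ p (i + 1). The first
-- inequality has a rational margin, so evaluating all sequences at one late index reduces the claim
-- to rationals.
pivots-increasing : ∀ α → 1ℝ ≤ℝ α → ∀ p → ArePivots α p → ∀ i → p i ℕ.< p (suc i)
pivots-increasing α 1≤α p pivots i = from (pivots i) (pivots (suc i))
  where
  from : IsCeiling (powerSum α i) (p i) → IsCeiling (powerSum α (suc i)) (p (suc i)) → p i ℕ.< p (suc i)
  from (_ , e , 0<e , N₁ , below) (above , _) = ℕₚ.≰⇒> λ p[1+i]≤p[i] → ℚₚ.<-irrefl refl (ℚₚ.<-≤-trans
    (<-from-halves (ℤ.+ p i ℚ./ 1) (ℤ.+ p (suc i) ℚ./ 1) (seq (powerSum α i) n) (seq (α ^ℝ suc i) n)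
      (0<½* 0<e) (½*+½* e) (½*+½* (½ ℚ.* e))
      (below n (ℕₚ.m≤m⊔n N₁ (N₂ ℕ.⊔ N₃)))
      (proj₂ large n (ℕₚ.≤-trans (ℕₚ.m≤n⊔m N₂ N₃) (ℕₚ.m≤n⊔m N₁ (N₂ ℕ.⊔ N₃))))
      (proj₂ above′ n (ℕₚ.≤-trans (ℕₚ.m≤m⊔n N₂ N₃) (ℕₚ.m≤n⊔m N₁ (N₂ ℕ.⊔ N₃)))))
    (/1-mono-≤ p[1+i]≤p[i]))
    where
    δ = ½ ℚ.* (½ ℚ.* e)
    above′ = above δ (0<½* (0<½* 0<e))
    large = 1≤ℝ^ α 1≤α (suc i) δ (0<½* (0<½* 0<e))
    N₂ = proj₁ above′
    N₃ = proj₁ large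
    n = N₁ ℕ.⊔ (N₂ ℕ.⊔ N₃)

-- Cost of splitting at the closest pivot

-- The difference of a and b appears as two truncated differences because each is charged to a
-- different child of the split.
+≡⊓+⊓+∸+∸ : ∀ a b → a + b ≡ (a ⊓ b + a ⊓ b) + ((b ∸ a) + (a ∸ b))
+≡⊓+⊓+∸+∸ a b = begin
  a + b                                            ≡⟨ cong₂ _+_ (trans (cong (_+ (a ∸ b)) (⊓-comm a b)) (m⊓n+n∸m≡n b a)) (m⊓n+n∸m≡n a b) ⟨
  (a ⊓ b + (a ∸ b)) + (a ⊓ b + (b ∸ a))            ≡⟨ solve 3 (λ x y z → (x :+ y) :+ (x :+ z) := (x :+ x) :+ (z :+ y)) refl (a ⊓ b) (a ∸ b) (b ∸ a) ⟩
  (a ⊓ b + a ⊓ b) + ((b ∸ a) + (a ∸ b))            ∎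
  where
  open ≡-Reasoning
  open ℕ-Solver.+-*-Solver

-- In doubled distances: a point at distance o from the middle has its mirror image o indices away,
-- and moving z indices towards it, short of the image, brings the point strictly closer to the
-- middle.
0<z<o⇒∣o-2z∣<o : ∀ {o z} → 0 < z → z < o → ∣ o - 2 * z ∣ < o
0<z<o⇒∣o-2z∣<o {o} {z} 0<z z<o with ≤-total (2 * z) o
... | inj₁ 2z≤o = subst (_< o) (sym (m≤n⇒∣n-m∣≡n∸m 2z≤o))
  (∸-monoʳ-< {o} {2 * z} {0} (*-monoʳ-< 2 0<z) 2z≤o)
... | inj₂ o≤2z = subst (_< o) (sym (m≤n⇒∣m-n∣≡n∸m o≤2z)) (begin-strict
  2 * z ∸ o   <⟨ ∸-monoˡ-< (*-monoʳ-< 2 z<o) o≤2z ⟩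
  2 * o ∸ o   ≡⟨ m+n∸m≡n o (o + 0) ⟩
  o + 0       ≡⟨ +-identityʳ o ⟩
  o           ∎)
  where open ≤-Reasoning

-- A segment of m indices from s on, split at pivots x.  The left part ends e
-- indices before x: e = 0 for the algorithm and e = 1 for the recurrence of r.
data SplitTree (p : ℕ → ℕ) : ℕ → ℕ → Set where
  leaf : ∀ {s m} → SplitTree p s m
  node : ∀ {s m} a e b x → x ≡ s + (a + e) → m ≡ (a + e) + suc b →
         ClosestPivot p s (s + m) x →
         SplitTree p s a → SplitTree p (suc x) b → SplitTree p s m

module _ {p : ℕ → ℕ} where

  totalSize : SplitTree p s m → ℕ
  totalSize leaf                             = 0
  totalSize (node {m = m} _ _ _ _ _ _ _ l r) = m + (totalSize l + totalSize r)

  -- The two sides are the indices below x and those from x on, which is how a LOHification has to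
  -- separate them. The e dropped indices thus count on the left and x itself on the right.
  swaps : SplitTree p s m → ℕ
  swaps leaf                         = 0
  swaps (node a e b _ _ _ _ l r) = (a + e) ⊓ suc b + (swaps l + swaps r)

  -- Reflecting x in the middle of the segment shows that no pivot other than
  -- x lies between x and its mirror image.
  no-pivot-right : ∀ {x a b y} → x ≡ s + a → m ≡ a + b → ClosestPivot p s (s + m) x →
                   PivotBetween p s (s + m) y → x < y → x + (b ∸ a) ≤ y
  no-pivot-right {s = s} {x = x} {a} {b} {y} refl refl (_ , closest) pivot x<y with ≤-total b a
  ... | inj₁ b≤a rewrite m≤n⇒m∸n≡0 b≤a | +-identityʳ (s + a) = <⇒≤ x<y
  ... | inj₂ a≤b with o , refl ← m≤n⇒∃[o]m+o≡n a≤b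
                    | z , refl ← m≤n⇒∃[o]m+o≡n (<⇒≤ x<y)
    rewrite m+n∸m≡n a o = +-monoʳ-≤ x (≮⇒≥ λ z<o → <-irrefl refl (begin-strict
      o                                     ≡⟨ ∣m-m+n∣≡n (2 * x) o ⟨
      ∣ 2 * x - 2 * x + o ∣                 ≡⟨ cong ∣ 2 * x -_∣ (middle s a o) ⟩
      ∣ 2 * x - (s + (s + (a + (a + o)))) ∣ ≤⟨ closest y pivot ⟩
      ∣ 2 * y - (s + (s + (a + (a + o)))) ∣ ≡⟨ cong₂ ∣_-_∣ (*-distribˡ-+ 2 x z) (sym (middle s a o)) ⟩
      ∣ 2 * x + 2 * z - 2 * x + o ∣         ≡⟨ ∣m+n-m+o∣≡∣n-o∣ (2 * x) (2 * z) o ⟩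
      ∣ 2 * z - o ∣                         ≡⟨ ∣-∣-comm (2 * z) o ⟩
      ∣ o - 2 * z ∣                         <⟨ 0<z<o⇒∣o-2z∣<o (+-cancelˡ-< x 0 z (subst (_< x + z) (sym (+-identityʳ x)) x<y)) z<o ⟩
      o                                     ∎))
    where
    open ≤-Reasoning
    middle : ∀ s a o → 2 * (s + a) + o ≡ s + (s + (a + (a + o)))
    middle = solve 3 (λ s a o → con 2 :* (s :+ a) :+ o := s :+ (s :+ (a :+ (a :+ o)))) refl
      where open ℕ-Solver.+-*-Solver

  no-pivot-left : ∀ {x a b y} → x ≡ s + a → m ≡ a + b → ClosestPivot p s (s + m) x →
                  PivotBetween p s (s + m) y → y < x → y + (a ∸ b) ≤ x
  no-pivot-left {s = s} {x = x} {a} {b} {y} x≡s+a refl (_ , closest) pivot y<x with ≤-total a b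
  ... | inj₁ a≤b rewrite m≤n⇒m∸n≡0 a≤b | +-identityʳ y = <⇒≤ y<x
  ... | inj₂ b≤a with o , refl ← m≤n⇒∃[o]m+o≡n b≤a
                    | z , refl ← m≤n⇒∃[o]m+o≡n (<⇒≤ y<x)
    rewrite m+n∸m≡n b o = +-monoʳ-≤ y (≮⇒≥ λ z<o → <-irrefl refl (begin-strict
      o                         ≡⟨ ∣m-m+n∣≡n c o ⟨
      ∣ c - c + o ∣             ≡⟨ ∣-∣-comm c (c + o) ⟩
      ∣ c + o - c ∣             ≡⟨ cong ∣_- c ∣ (trans (middle s b o) (cong (2 *_) (sym x≡s+a))) ⟩
      ∣ 2 * x - c ∣             ≤⟨ closest y pivot ⟩
      ∣ 2 * y - c ∣             ≡⟨ ∣m+n-m+o∣≡∣n-o∣ (2 * z) (2 * y) c ⟨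
      -- Adding 2 z to both arguments turns 2 y into 2 x = c + o.
      ∣ 2 * z + 2 * y - 2 * z + c ∣ ≡⟨ cong₂ ∣_-_∣ doubled (+-comm (2 * z) c) ⟩
      ∣ c + o - c + 2 * z ∣     ≡⟨ ∣m+n-m+o∣≡∣n-o∣ c o (2 * z) ⟩
      ∣ o - 2 * z ∣             <⟨ 0<z<o⇒∣o-2z∣<o (+-cancelˡ-< y 0 z (subst (_< y + z) (sym (+-identityʳ y)) y<x)) z<o ⟩
      o                         ∎))
    where
    open ≤-Reasoning
    c = s + (s + ((b + o) + b))
    middle : ∀ s b o → (s + (s + ((b + o) + b))) + o ≡ 2 * (s + (b + o))
    middle = solve 3 (λ s b o → (s :+ (s :+ ((b :+ o) :+ b))) :+ o := con 2 :* (s :+ (b :+ o))) refl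
      where open ℕ-Solver.+-*-Solver
    doubled : 2 * z + 2 * y ≡ c + o
    doubled = trans (+-comm (2 * z) (2 * y)) (trans (sym (*-distribˡ-+ 2 y z))
                (trans (cong (2 *_) x≡s+a) (sym (middle s b o))))

  -- f and g are lengths of pivot-free ends of the segment.  Since
  -- a + b = 2 (a ⊓ b) + ∣ a - b ∣, the size of a segment is paid for by the
  -- swaps available at its split and by the gap on one side of the split.
  totalSize+gaps : (t : SplitTree p s m) → ∀ {f g} → f ≤ m → g ≤ m →
    (∀ {y} → PivotBetween p s (s + m) y → s + f ≤ y) →
    (∀ {y} → PivotBetween p s (s + m) y → y + g ≤ s + m) →
    totalSize t + (f + g) ≤ 2 * swaps t + 2 * m
  -- Both pivot-free ends may cover the whole leaf, which accounts for the summand 2 m.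
  totalSize+gaps {m = m} leaf {f} {g} f≤m g≤m _ _ =
    ≤-trans (+-mono-≤ f≤m g≤m) (≤-reflexive (cong (m +_) (sym (+-identityʳ m))))
  totalSize+gaps {s = s} (node a e b x refl refl c@((px , s<x , x<s+m) , _) l r) {f} {g} f≤m g≤m f-free g-free =
    combine (swaps l) (swaps r) (totalSize l) (totalSize r)
      (totalSize+gaps l (m⊓n≤n f a) g₁≤a f₁-free g₁-free)
      (totalSize+gaps r f₂≤b (m⊓n≤n g b) f₂-free g₂-free)
      f≤f₁+e g≤g₂+1 (m≤n+m∸n A-B e) (m≤n+m∸n B-A 1)
    where
    A = a + e
    B = suc b
    A-B = A ∸ B
    B-A = B ∸ A
    -- Each child inherits the outer gap on its side, cut to its own length, and receives the gap
    -- beside x as its inner one. The indices outside both children shorten the inner gaps, by e on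
    -- the left and by 1, for x itself, on the right.
    f₁ = f ⊓ a
    g₁ = A-B ∸ e
    f₂ = B-A ∸ 1
    g₂ = g ⊓ b
    f≤A : f ≤ A
    f≤A = +-cancelˡ-≤ s f A (f-free (px , s<x , x<s+m))
    g≤B : g ≤ B
    g≤B = +-cancelˡ-≤ x g B (≤-trans (g-free (px , s<x , x<s+m)) (≤-reflexive (sym (+-assoc s A B))))
    f≤f₁+e : f ≤ f₁ + e
    f≤f₁+e = ≤-trans (⊓-glb (m≤m+n f e) f≤A) (≤-reflexive (sym (+-distribʳ-⊓ e f a)))
    g≤g₂+1 : g ≤ g₂ + 1
    g≤g₂+1 = ≤-trans (⊓-glb (m≤m+n g 1) (≤-trans g≤B (≤-reflexive (+-comm 1 b)))) (≤-reflexive (sym (+-distribʳ-⊓ 1 g b)))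
    g₁≤a : g₁ ≤ a
    g₁≤a = ≤-trans (∸-monoˡ-≤ e (m∸n≤m A B)) (≤-reflexive (m+n∸n≡m a e))
    f₂≤b : f₂ ≤ b
    f₂≤b = ∸-monoˡ-≤ 1 (m∸n≤m B A)
    fromLeft : ∀ {y} → PivotBetween p s (s + a) y → y < x × PivotBetween p s (s + (A + B)) y
    fromLeft (py , s<y , y<s+a) = y<x , py , s<y , <-trans y<x x<s+m
      where y<x = <-≤-trans y<s+a (+-monoʳ-≤ s (m≤m+n a e))
    right-end : suc x + b ≡ s + (A + B)
    right-end = trans (sym (+-suc x b)) (+-assoc s A B)
    fromRight : ∀ {y} → PivotBetween p (suc x) (suc x + b) y → x < y × PivotBetween p s (s + (A + B)) y
    fromRight {y} (py , x<y , y<) = <⇒≤ x<y , py , <-trans s<x (<⇒≤ x<y) , subst (y <_) right-end y<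
    f₁-free : ∀ {y} → PivotBetween p s (s + a) y → s + f₁ ≤ y
    f₁-free py = ≤-trans (+-monoʳ-≤ s (m⊓n≤m f a)) (f-free (proj₂ (fromLeft py)))
    g₁-free : ∀ {y} → PivotBetween p s (s + a) y → y + g₁ ≤ s + a
    g₁-free {y} q@(_ , _ , y<s+a) with ≤-total A-B e
    ... | inj₁ A-B≤e rewrite m≤n⇒m∸n≡0 A-B≤e | +-identityʳ y = <⇒≤ y<s+a
    ... | inj₂ e≤A-B with y<x , py ← fromLeft q = +-cancelʳ-≤ e (y + g₁) (s + a) (begin
      y + g₁ + e     ≡⟨ +-assoc y g₁ e ⟩
      y + (g₁ + e)   ≡⟨ cong (y +_) (m∸n+n≡m e≤A-B) ⟩
      y + A-B        ≤⟨ no-pivot-left {s = s} refl refl c py y<x ⟩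
      s + (a + e)    ≡⟨ +-assoc s a e ⟨
      s + a + e      ∎)
      where open ≤-Reasoning
    f₂-free : ∀ {y} → PivotBetween p (suc x) (suc x + b) y → suc x + f₂ ≤ y
    f₂-free {y} q@(_ , sx<y , _) with ≤-total B-A 1
    ... | inj₁ B-A≤1 rewrite m≤n⇒m∸n≡0 B-A≤1 | +-identityʳ x = <⇒≤ sx<y
    ... | inj₂ 1≤B-A with x<y , py ← fromRight q = begin
      suc x + f₂     ≡⟨ +-suc x f₂ ⟨
      x + (1 + f₂)   ≡⟨ cong (x +_) (m+[n∸m]≡n 1≤B-A) ⟩
      x + B-A        ≤⟨ no-pivot-right {s = s} refl refl c py x<y ⟩
      y              ∎
      where open ≤-Reasoning
    g₂-free : ∀ {y} → PivotBetween p (suc x) (suc x + b) y → y + g₂ ≤ suc x + b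
    g₂-free {y} q = ≤-trans (+-monoʳ-≤ y (m⊓n≤m g b)) (≤-trans (g-free (proj₂ (fromRight q))) (≤-reflexive (sym right-end)))
    -- The four gaps lose e twice and 1 twice, exactly the 2 (e + 1) by which 2 (A + B) exceeds 2 a
    -- + 2 b.
    combine : ∀ kl kr tl tr {f₁ g₁ f₂ g₂} → tl + (f₁ + g₁) ≤ 2 * kl + 2 * a → tr + (f₂ + g₂) ≤ 2 * kr + 2 * b →
      f ≤ f₁ + e → g ≤ g₂ + 1 → A-B ≤ e + g₁ → B-A ≤ 1 + f₂ →
      A + B + (tl + tr) + (f + g) ≤ 2 * (A ⊓ B + (kl + kr)) + 2 * (A + B)
    combine kl kr tl tr {f₁} {g₁} {f₂} {g₂} hl hr hf hg hd hd′ = begin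
      A + B + (tl + tr) + (f + g)
        ≡⟨ cong (λ z → z + (tl + tr) + (f + g)) (+≡⊓+⊓+∸+∸ A B) ⟩
      (A ⊓ B + A ⊓ B) + (B-A + A-B) + (tl + tr) + (f + g)
        ≤⟨ +-mono-≤ (+-monoˡ-≤ (tl + tr) (+-monoʳ-≤ (A ⊓ B + A ⊓ B) (+-mono-≤ hd′ hd))) (+-mono-≤ hf hg) ⟩
      (A ⊓ B + A ⊓ B) + ((1 + f₂) + (e + g₁)) + (tl + tr) + ((f₁ + e) + (g₂ + 1))
        ≡⟨ solve 8 (λ k tl tr f₁ g₁ f₂ g₂ e →
             (k :+ k) :+ ((con 1 :+ f₂) :+ (e :+ g₁)) :+ (tl :+ tr) :+ ((f₁ :+ e) :+ (g₂ :+ con 1)) :=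
             con 2 :* k :+ ((tl :+ (f₁ :+ g₁)) :+ (tr :+ (f₂ :+ g₂))) :+ con 2 :* (e :+ con 1))
             refl (A ⊓ B) tl tr f₁ g₁ f₂ g₂ e ⟩
      2 * (A ⊓ B) + ((tl + (f₁ + g₁)) + (tr + (f₂ + g₂))) + 2 * (e + 1)
        ≤⟨ +-monoˡ-≤ (2 * (e + 1)) (+-monoʳ-≤ (2 * (A ⊓ B)) (+-mono-≤ hl hr)) ⟩
      2 * (A ⊓ B) + ((2 * kl + 2 * a) + (2 * kr + 2 * b)) + 2 * (e + 1)
        ≡⟨ solve 6 (λ k kl kr a b e →
             con 2 :* k :+ ((con 2 :* kl :+ con 2 :* a) :+ (con 2 :* kr :+ con 2 :* b)) :+ con 2 :* (e :+ con 1) :=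
             con 2 :* (k :+ (kl :+ kr)) :+ con 2 :* ((a :+ e) :+ (con 1 :+ b)))
             refl (A ⊓ B) kl kr a b e ⟩
      2 * (A ⊓ B + (kl + kr)) + 2 * (A + B) ∎
      where
      open ≤-Reasoning
      open ℕ-Solver.+-*-Solver

  totalSize≤ : (t : SplitTree p s m) → totalSize t ≤ 2 * swaps t + 2 * m
  totalSize≤ {s = s} {m} t = subst (_≤ 2 * swaps t + 2 * m) (+-identityʳ (totalSize t)) (totalSize+gaps t z≤n z≤n
    (λ (_ , s<y , _) → ≤-trans (≤-reflexive (+-identityʳ s)) (<⇒≤ s<y))
    (λ {y} (_ , _ , y<s+m) → ≤-trans (≤-reflexive (+-identityʳ y)) (<⇒≤ y<s+m)))

-- Independent exchanges

range : ℕ → ℕ → List ℕ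
range s zero    = []
range s (suc m) = s ∷ range (suc s) m

range-++ : ∀ s m k → range s m ++ range (s + m) k ≡ range s (m + k)
range-++ s zero    k = cong (λ s → range s k) (+-identityʳ s)
range-++ s (suc m) k = cong (s ∷_) (trans (cong (λ z → range (suc s) m ++ range z k) (+-suc s m)) (range-++ (suc s) m k))

length-range : ∀ s m → length (range s m) ≡ m
length-range s zero    = refl
length-range s (suc m) = cong suc (length-range (suc s) m)

range-bounds : ∀ s m → All (λ y → s ≤ y × y < s + m) (range s m)
range-bounds s zero    = []
range-bounds s (suc m) = (≤-refl , m<m+n s z<s) ∷
  All.map (λ {y} (s<y , y<) → <⇒≤ s<y , subst (y <_) (sym (+-suc s m)) y<) (range-bounds (suc s) m)

-- Each bit orders one adjacent pair, so it can be read off from which side of the split comes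
-- first, while the order within either list is preserved and can be recovered by filtering. With at
-- most as many bits as elements in each list, as in `word`, the clauses for an exhausted list are
-- never reached.
interleave : Vec Bool k → List X → List X → List X
interleave []           u       v       = u ++ v
interleave (_     ∷ _)  []      v       = v
interleave (_     ∷ _)  (a ∷ u) []      = a ∷ u
interleave (true  ∷ bs) (a ∷ u) (c ∷ v) = a ∷ c ∷ interleave bs u v
interleave (false ∷ bs) (a ∷ u) (c ∷ v) = c ∷ a ∷ interleave bs u v

interleave-↭ : (bs : Vec Bool k) (u v : List X) → interleave bs u v ↭ u ++ v
interleave-↭ []       u       v  = ↭-refl
interleave-↭ (b ∷ bs) []      v  = ↭-refl
interleave-↭ (b ∷ bs) (a ∷ u) [] = ↭-reflexive (sym (List.++-identityʳ (a ∷ u)))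
interleave-↭ (true ∷ bs) (a ∷ u) (c ∷ v) =
  prep a (↭-trans (prep c (interleave-↭ bs u v)) (↭-sym (shift c u v)))
interleave-↭ (false ∷ bs) (a ∷ u) (c ∷ v) =
  ↭-trans (prep c (prep a (interleave-↭ bs u v))) (↭-sym (shift c (a ∷ u) v))

filter-interleave-< : ∀ (bs : Vec Bool k) {u v} → All (_< x) u → All (x ≤_) v →
  filter (_<? x) (interleave bs u v) ≡ u
filter-interleave-< {x = x} [] {u} {v} u<x x≤v = begin
  filter (_<? x) (u ++ v)                   ≡⟨ List.filter-++ (_<? x) u v ⟩
  filter (_<? x) u ++ filter (_<? x) v      ≡⟨ cong₂ _++_ (List.filter-all (_<? x) u<x) (List.filter-none (_<? x) (All.map ≤⇒≯ x≤v)) ⟩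
  u ++ []                                   ≡⟨ List.++-identityʳ u ⟩
  u                                         ∎
  where open ≡-Reasoning
filter-interleave-< {x = x} (_ ∷ _) [] x≤v = List.filter-none (_<? x) (All.map ≤⇒≯ x≤v)
filter-interleave-< {x = x} (_ ∷ _) (a<x ∷ u<x) [] = List.filter-all (_<? x) (a<x ∷ u<x)
filter-interleave-< {x = x} (true ∷ bs) (a<x ∷ u<x) (x≤c ∷ x≤v) =
  trans (List.filter-accept (_<? x) a<x) (cong (_ ∷_)
    (trans (List.filter-reject (_<? x) (≤⇒≯ x≤c)) (filter-interleave-< bs u<x x≤v)))
filter-interleave-< {x = x} (false ∷ bs) (a<x ∷ u<x) (x≤c ∷ x≤v) =
  trans (List.filter-reject (_<? x) (≤⇒≯ x≤c))
    (trans (List.filter-accept (_<? x) a<x) (cong (_ ∷_) (filter-interleave-< bs u<x x≤v)))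

filter-interleave-≥ : ∀ (bs : Vec Bool k) {u v} → All (_< x) u → All (x ≤_) v →
  filter (x ≤?_) (interleave bs u v) ≡ v
filter-interleave-≥ {x = x} [] {u} {v} u<x x≤v = begin
  filter (x ≤?_) (u ++ v)                   ≡⟨ List.filter-++ (x ≤?_) u v ⟩
  filter (x ≤?_) u ++ filter (x ≤?_) v      ≡⟨ cong₂ _++_ (List.filter-none (x ≤?_) (All.map <⇒≱ u<x)) (List.filter-all (x ≤?_) x≤v) ⟩
  v                                         ∎
  where open ≡-Reasoning
filter-interleave-≥ {x = x} (_ ∷ _) [] x≤v = List.filter-all (x ≤?_) x≤v
filter-interleave-≥ {x = x} (_ ∷ _) (a<x ∷ u<x) [] = List.filter-none (x ≤?_) (All.map <⇒≱ (a<x ∷ u<x))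
filter-interleave-≥ {x = x} (true ∷ bs) (a<x ∷ u<x) (x≤c ∷ x≤v) =
  trans (List.filter-reject (x ≤?_) (<⇒≱ a<x))
    (trans (List.filter-accept (x ≤?_) x≤c) (cong (_ ∷_) (filter-interleave-≥ bs u<x x≤v)))
filter-interleave-≥ {x = x} (false ∷ bs) (a<x ∷ u<x) (x≤c ∷ x≤v) =
  trans (List.filter-accept (x ≤?_) x≤c) (cong (_ ∷_)
    (trans (List.filter-reject (x ≤?_) (<⇒≱ a<x)) (filter-interleave-≥ bs u<x x≤v)))

SameSide : ℕ → ℕ → ℕ → Set
SameSide y a b = (a < y → b < y) × (b < y → a < y)

-- Where the bits first differ, one list has an entry below x and the other an entry from x on at
-- the same position. The length bounds ensure that every bit finds a pair to order.
interleave-injective : ∀ (bs bs′ : Vec Bool k) {u v u′ v′} →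
  All (_< x) u → All (x ≤_) v → All (_< x) u′ → All (x ≤_) v′ →
  k ≤ length u → k ≤ length v → k ≤ length u′ → k ≤ length v′ →
  Pointwise (SameSide x) (interleave bs u v) (interleave bs′ u′ v′) → bs ≡ bs′
interleave-injective [] [] _ _ _ _ _ _ _ _ _ = refl
interleave-injective (true ∷ bs) (true ∷ bs′) (_ ∷ u) (_ ∷ v) (_ ∷ u′) (_ ∷ v′) (s≤s k≤u) (s≤s k≤v) (s≤s k≤u′) (s≤s k≤v′) (_ ∷ _ ∷ same) =
  cong (true ∷_) (interleave-injective bs bs′ u v u′ v′ k≤u k≤v k≤u′ k≤v′ same)
interleave-injective (false ∷ bs) (false ∷ bs′) (_ ∷ u) (_ ∷ v) (_ ∷ u′) (_ ∷ v′) (s≤s k≤u) (s≤s k≤v) (s≤s k≤u′) (s≤s k≤v′) (_ ∷ _ ∷ same) =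
  cong (false ∷_) (interleave-injective bs bs′ u v u′ v′ k≤u k≤v k≤u′ k≤v′ same)
interleave-injective (true ∷ _) (false ∷ _) (a<x ∷ _) (_ ∷ _) (_ ∷ _) (x≤c ∷ _) (s≤s _) (s≤s _) (s≤s _) (s≤s _) (same ∷ _) =
  contradiction (proj₁ same a<x) (≤⇒≯ x≤c)
interleave-injective (false ∷ _) (true ∷ _) (_ ∷ _) (x≤c ∷ _) (a<x ∷ _) (_ ∷ _) (s≤s _) (s≤s _) (s≤s _) (s≤s _) (same ∷ _) =
  contradiction (proj₂ same a<x) (≤⇒≯ x≤c)

module _ {p : ℕ → ℕ} where

  -- A rearrangement of the indices of a segment.  At a split, each bit tells
  -- in which order one index from either side is stored.
  word : (t : SplitTree p s m) → Vec Bool (swaps t) → List ℕ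
  leftWord : ∀ s a e → (l : SplitTree p s a) → Vec Bool (swaps l) → List ℕ
  rightWord : ∀ x {b} → (r : SplitTree p (suc x) b) → Vec Bool (swaps r) → List ℕ

  word {s = s} {m} leaf _ = range s m
  word {s = s} (node a e b x _ _ _ l r) bs =
    interleave (Vec.take ((a + e) ⊓ suc b) bs)
      (leftWord s a e l (Vec.take (swaps l) (Vec.drop ((a + e) ⊓ suc b) bs)))
      (rightWord x r (Vec.drop (swaps l) (Vec.drop ((a + e) ⊓ suc b) bs)))

  -- The e indices outside both parts go in front, where `word-injective` cancels them as a common
  -- prefix.
  leftWord s a e l bs = range (s + a) e ++ word l bs
  rightWord x r bs = x ∷ word r bs

  word-↭ : (t : SplitTree p s m) (bs : Vec Bool (swaps t)) → word t bs ↭ range s m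
  leftWord-↭ : ∀ s a e (l : SplitTree p s a) bs → leftWord s a e l bs ↭ range s (a + e)
  rightWord-↭ : ∀ x {b} (r : SplitTree p (suc x) b) bs → rightWord x r bs ↭ range x (suc b)

  word-↭ leaf bs = ↭-refl
  word-↭ {s = s} (node a e b x refl refl _ l r) bs = begin
    interleave cs u v                         ↭⟨ interleave-↭ cs u v ⟩
    u ++ v                                    ↭⟨ ++⁺ (leftWord-↭ s a e l _) (rightWord-↭ x r _) ⟩
    range s (a + e) ++ range x (suc b)        ≡⟨ range-++ s (a + e) (suc b) ⟩
    range s (a + e + suc b)                   ∎
    where
    open PermutationReasoning
    cs = Vec.take ((a + e) ⊓ suc b) bs
    u = leftWord s a e l (Vec.take (swaps l) (Vec.drop ((a + e) ⊓ suc b) bs))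
    v = rightWord x r (Vec.drop (swaps l) (Vec.drop ((a + e) ⊓ suc b) bs))

  leftWord-↭ s a e l bs = begin
    range (s + a) e ++ word l bs   ↭⟨ ++-comm (range (s + a) e) (word l bs) ⟩
    word l bs ++ range (s + a) e   ↭⟨ ++⁺ (word-↭ l bs) ↭-refl ⟩
    range s a ++ range (s + a) e   ≡⟨ range-++ s a e ⟩
    range s (a + e)                ∎
    where
    open PermutationReasoning

  rightWord-↭ x r bs = prep x (word-↭ r bs)

  -- Words are read as inputs, listing the rank of the element at each position. The relation is
  -- what two inputs must satisfy if one output is correct for both.
  Indistinguishable : ℕ → ℕ → List ℕ → List ℕ → Set
  Indistinguishable s m = Pointwise λ a b → ∀ y → PivotBetween p s (s + m) y → SameSide y a b

  -- The pivot x alone determines the bits of the top split. Corresponding entries lie on the same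
  -- side of x, so filtering by x preserves the correspondence and leaves the words of the two parts
  -- for the induction.
  word-injective : (t : SplitTree p s m) (bs bs′ : Vec Bool (swaps t)) →
    Indistinguishable s m (word t bs) (word t bs′) → bs ≡ bs′
  word-injective leaf [] [] _ = refl
  word-injective {s = s} (node a e b x refl refl c@(px , _) l r) bs bs′ ind = begin
    bs                                 ≡⟨ Vec.take++drop≡id A⊓B bs ⟨
    Vec.take A⊓B bs Vec.++ ds          ≡⟨ cong₂ Vec._++_ heads tails ⟩
    Vec.take A⊓B bs′ Vec.++ ds′        ≡⟨ Vec.take++drop≡id A⊓B bs′ ⟩
    bs′                                ∎
    where
    open ≡-Reasoning
    A⊓B = (a + e) ⊓ suc b
    ds = Vec.drop A⊓B bs
    ds′ = Vec.drop A⊓B bs′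
    u = λ cs → leftWord s a e l (Vec.take (swaps l) cs)
    v = λ cs → rightWord x r (Vec.drop (swaps l) cs)
    u< : ∀ cs → All (_< x) (u cs)
    u< cs = All-resp-↭ (↭-sym (leftWord-↭ s a e l _)) (All.map proj₂ (range-bounds s (a + e)))
    v≥ : ∀ cs → All (x ≤_) (v cs)
    v≥ cs = All-resp-↭ (↭-sym (rightWord-↭ x r _)) (All.map proj₁ (range-bounds x (suc b)))
    k≤u : ∀ cs → A⊓B ≤ length (u cs)
    k≤u cs = ≤-trans (m⊓n≤m (a + e) (suc b))
      (≤-reflexive (sym (trans (↭-length (leftWord-↭ s a e l (Vec.take (swaps l) cs))) (length-range s (a + e)))))
    k≤v : ∀ cs → A⊓B ≤ length (v cs)
    k≤v cs = ≤-trans (m⊓n≤n (a + e) (suc b))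
      (≤-reflexive (sym (trans (↭-length (rightWord-↭ x r (Vec.drop (swaps l) cs))) (length-range x (suc b)))))
    heads = interleave-injective (Vec.take A⊓B bs) (Vec.take A⊓B bs′)
      (u< ds) (v≥ ds) (u< ds′) (v≥ ds′) (k≤u ds) (k≤v ds) (k≤u ds′) (k≤v ds′)
      (Pointwise.map (λ same → same x px) ind)
    lefts : Indistinguishable s (a + e + suc b) (u ds) (u ds′)
    lefts = subst₂ (Indistinguishable s (a + e + suc b))
      (filter-interleave-< (Vec.take A⊓B bs) (u< ds) (v≥ ds)) (filter-interleave-< (Vec.take A⊓B bs′) (u< ds′) (v≥ ds′))
      (Pointwise.filter⁺ (_<? x) (_<? x) (λ same → proj₁ (same x px)) (λ same → proj₂ (same x px)) ind)
    rights : Indistinguishable s (a + e + suc b) (v ds) (v ds′)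
    rights = subst₂ (Indistinguishable s (a + e + suc b))
      (filter-interleave-≥ (Vec.take A⊓B bs) (u< ds) (v≥ ds)) (filter-interleave-≥ (Vec.take A⊓B bs′) (u< ds′) (v≥ ds′))
      (Pointwise.filter⁺ (x ≤?_) (x ≤?_) (λ same x≤a → ≮⇒≥ (λ b<x → <⇒≱ (proj₂ (same x px) b<x) x≤a))
        (λ same x≤b → ≮⇒≥ (λ a<x → <⇒≱ (proj₁ (same x px) a<x) x≤b)) ind)
    left≡ : Vec.take (swaps l) ds ≡ Vec.take (swaps l) ds′
    left≡ = word-injective l _ _ (Pointwise.map
      (λ same y (py , s<y , y<) → same y (py , s<y , <-≤-trans y< (+-monoʳ-≤ s (≤-trans (m≤m+n a e) (m≤m+n (a + e) (suc b))))))
      (Pointwise.++-cancelˡ (range (s + a) e) lefts))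
    right≡ : Vec.drop (swaps l) ds ≡ Vec.drop (swaps l) ds′
    right≡ = word-injective r _ _ (Pointwise.map
      (λ same y (py , x<y , y<) → same y (py , <-trans (proj₁ (proj₂ px)) (<⇒≤ x<y) ,
         subst (y <_) (trans (sym (+-suc x b)) (+-assoc s (a + e) (suc b))) y<))
      (Pointwise.tail rights))
    tails : ds ≡ ds′
    tails = trans (sym (Vec.take++drop≡id (swaps l) ds))
      (trans (cong₂ Vec._++_ left≡ right≡) (Vec.take++drop≡id (swaps l) ds′))

-- Decision trees

length-filter-∁ : ∀ {a p} {A : Set a} {P : Pred A p} (P? : Decidable P) xs →
  length (filter P? xs) + length (filter (∁? P?) xs) ≡ length xs
length-filter-∁ P? [] = refl
length-filter-∁ P? (x ∷ xs) with P? x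
... | yes _ = cong suc (length-filter-∁ P? xs)
... | no  _ = trans (+-suc _ _) (cong suc (length-filter-∁ P? xs))

module _ {A X R : Set} (answers : A → X → X → Bool) where

  InjectiveOn : List A → Comp X R → Set
  InjectiveOn S t = ∀ {a b} → a ∈ S → b ∈ S → result (answers a) t ≡ result (answers b) t → a ≡ b

  -- Each comparison sends the inputs in S to two subtrees, whose budgets are smaller by one. Inputs
  -- that reach the same `return` have the same result, so injectivity leaves at most one there.
  length≤2^cost : ∀ t S {D} → Unique S → InjectiveOn S t →
    (∀ {a} → a ∈ S → cost (answers a) t ≤ D) → length S ≤ 2 ^ D
  length≤2^cost (return r) [] _ _ _ = z≤n
  length≤2^cost (return r) (a ∷ []) {D} _ _ _ = ^-monoʳ-≤ 2 {0} {D} z≤n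
  length≤2^cost (return r) (a ∷ b ∷ S) ((a≢b ∷ _) ∷ _) inj _ =
    contradiction (inj (here refl) (there (here refl)) refl) a≢b
  length≤2^cost (step t) S uniq inj bound =
    length≤2^cost t S uniq inj (λ a∈S → ≤-trans (n≤1+n _) (bound a∈S))
  length≤2^cost (compare x y k) [] _ _ _ = z≤n
  length≤2^cost (compare x y k) (a ∷ S) {zero} _ _ bound = contradiction (bound (here refl)) λ ()
  length≤2^cost (compare x y k) S@(_ ∷ _) {suc D} uniq inj bound = begin
    length S                                         ≡⟨ length-filter-∁ yes? S ⟨
    length (filter yes? S) + length (filter (∁? yes?) S)
      ≤⟨ +-mono-≤ (half true yes? proj₂) (half false (∁? yes?) (Bool.¬-not ∘ proj₂)) ⟩
    2 ^ D + 2 ^ D                                    ≡⟨ cong (2 ^ D +_) (+-identityʳ (2 ^ D)) ⟨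
    2 ^ suc D                                        ∎
    where
    open ≤-Reasoning
    yes? : Decidable (λ a → answers a x y ≡ true)
    yes? a = answers a x y Bool.≟ true
    half : ∀ b {P : A → Set} (P? : Decidable P) → (∀ {a} → a ∈ S × P a → answers a x y ≡ b) →
           length (filter P? S) ≤ 2 ^ D
    half b P? answer≡b = length≤2^cost (k b) (filter P? S) (Unique.filter⁺ P? uniq)
      (λ {a₁} {a₂} a₁∈ a₂∈ eq → inj (proj₁ (∈-filter⁻ P? a₁∈)) (proj₁ (∈-filter⁻ P? a₂∈))
        (subst₂ (λ b₁ b₂ → result (answers a₁) (k b₁) ≡ result (answers a₂) (k b₂))
          (sym (answer≡b (∈-filter⁻ P? a₁∈))) (sym (answer≡b (∈-filter⁻ P? a₂∈))) eq))
      (λ {a} a∈ → s≤s⁻¹ (subst (λ b → suc (cost (answers a) (k b)) ≤ suc D)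
        (answer≡b (∈-filter⁻ P? a∈)) (bound (proj₁ (∈-filter⁻ P? a∈)))))

allBits : ∀ k → List (Vec Bool k)
allBits zero    = [] ∷ []
allBits (suc k) = List.map (true ∷_) (allBits k) ++ List.map (false ∷_) (allBits k)

length-allBits : ∀ k → length (allBits k) ≡ 2 ^ k
length-allBits zero    = refl
length-allBits (suc k) = begin
  length (List.map (true ∷_) (allBits k) ++ List.map (false ∷_) (allBits k))
    ≡⟨ List.length-++ (List.map (true ∷_) (allBits k)) ⟩
  length (List.map (true ∷_) (allBits k)) + length (List.map (false ∷_) (allBits k))
    ≡⟨ cong₂ _+_ (half true) (trans (half false) (sym (+-identityʳ (2 ^ k)))) ⟩
  2 ^ suc k ∎
  where
  open ≡-Reasoning
  half : ∀ b → length (List.map (b ∷_) (allBits k)) ≡ 2 ^ k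
  half b = trans (List.length-map (b ∷_) (allBits k)) (length-allBits k)

allBits-unique : ∀ k → Unique (allBits k)
allBits-unique zero    = [] ∷ []
allBits-unique (suc k) = Unique.++⁺
  (Unique.map⁺ Vec.∷-injectiveʳ (allBits-unique k))
  (Unique.map⁺ Vec.∷-injectiveʳ (allBits-unique k))
  (λ (in₁ , in₂) → disjoint (∈-map⁻ (true ∷_) in₁) (∈-map⁻ (false ∷_) in₂))
  where
  disjoint : ∀ {v : Vec Bool (suc k)} → (∃[ u ] u ∈ allBits k × v ≡ true ∷ u) →
             ¬ (∃[ u ] u ∈ allBits k × v ≡ false ∷ u)
  disjoint (_ , _ , refl) (_ , _ , ())

bits≤cost : ∀ {X R K D} (answers : Vec Bool K → X → X → Bool) (t : Comp X R) →
  (∀ {a b} → result (answers a) t ≡ result (answers b) t → a ≡ b) →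
  (∀ a → cost (answers a) t ≤ D) → K ≤ D
bits≤cost {K = K} {D} answers t inj bound = ≮⇒≥ λ D<K →
  <⇒≱ (^-monoʳ-< 2 (s≤s (s≤s z≤n)) D<K)
    (subst (_≤ 2 ^ D) (length-allBits K)
      (length≤2^cost answers t (allBits K) (allBits-unique K) (λ _ _ → inj) (λ {a} _ → bound a)))

-- The lower bound

Unique-resp-↭ : ∀ {A : Set} {xs ys : List A} → xs ↭ ys → Unique xs → Unique ys
Unique-resp-↭ {A} perm = ↭ₛ.Unique-resp-↭ (setoid A) (↭⇒↭ₛ perm)

module _ {A : Set} {P : A → Set} where

  take⁺ : ∀ {n} (xs : Vec A n) y → (∀ k → toℕ k < y → P (lookup xs k)) → All P (List.take y (toList xs))
  take⁺ xs       zero    _ = []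
  take⁺ []       (suc y) _ = []
  take⁺ (x ∷ xs) (suc y) h = h zero z<s ∷ take⁺ xs y (λ k k<y → h (suc k) (s<s k<y))

  take⁻ : ∀ {n} (xs : Vec A n) y → All P (List.take y (toList xs)) → ∀ k → toℕ k < y → P (lookup xs k)
  take⁻ (x ∷ xs) (suc y) (px ∷ _)   zero    _   = px
  take⁻ (x ∷ xs) (suc y) (_  ∷ pxs) (suc k) k<y = take⁻ xs y pxs k (s<s⁻¹ k<y)

  drop⁺ : ∀ {n} (xs : Vec A n) y → (∀ k → y ≤ toℕ k → P (lookup xs k)) → All P (List.drop y (toList xs))
  drop⁺ []       zero    _ = []
  drop⁺ (x ∷ xs) zero    h = h zero z≤n ∷ drop⁺ xs zero (λ k _ → h (suc k) z≤n)
  drop⁺ []       (suc y) _ = []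
  drop⁺ (x ∷ xs) (suc y) h = drop⁺ xs y (λ k y≤k → h (suc k) (s≤s y≤k))

  drop⁻ : ∀ {n} (xs : Vec A n) y → All P (List.drop y (toList xs)) → ∀ k → y ≤ toℕ k → P (lookup xs k)
  drop⁻ (x ∷ xs) zero    (px ∷ _)   zero    _   = px
  drop⁻ (x ∷ xs) zero    (_  ∷ pxs) (suc k) _   = drop⁻ xs zero pxs k z≤n
  drop⁻ (x ∷ xs) (suc y) pxs        (suc k) y≤k = drop⁻ xs y pxs k (s≤s⁻¹ y≤k)

lookup-pointwise : ∀ {A : Set} {R : A → A → Set} {n} (xs ys : Vec A n) →
  (∀ k → R (lookup xs k) (lookup ys k)) → Pointwise R (toList xs) (toList ys)
lookup-pointwise []       []       _ = []
lookup-pointwise (x ∷ xs) (y ∷ ys) h = h zero ∷ lookup-pointwise xs ys (h ∘ suc)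

lookup-injective : ∀ {A : Set} {n} (xs : Vec A n) → Unique (toList xs) →
  ∀ {i j} → lookup xs i ≡ lookup xs j → i ≡ j
lookup-injective (x ∷ xs) _ {zero} {zero} _ = refl
lookup-injective (x ∷ xs) (x∉ ∷ _) {zero} {suc j} eq = contradiction eq (drop⁻ xs 0 x∉ j z≤n)
lookup-injective (x ∷ xs) (x∉ ∷ _) {suc i} {zero} eq = contradiction (sym eq) (drop⁻ xs 0 x∉ i z≤n)
lookup-injective (x ∷ xs) (_ ∷ uniq) {suc i} {suc j} eq = cong suc (lookup-injective xs uniq eq)

range-unique : ∀ s m → Unique (range s m)
range-unique s zero    = []
range-unique s (suc m) = All.map (<⇒≢ ∘ proj₁) (range-bounds (suc s) m) ∷ range-unique (suc s) m

-- The condition that a single pivot y imposes on an output; being a LOH amounts to it holding at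
-- every pivot.
SortedAt : {A : Set} (_≤′_ : A → A → Set) → ℕ → List A → Set
SortedAt _≤′_ y xs = All (λ a → All (a ≤′_) (List.drop y xs)) (List.take y xs)

length-filter-range : ∀ y d → length (filter (_<? y) (range 0 (y + d))) ≡ y
length-filter-range y d = begin
  length (filter (_<? y) (range 0 (y + d)))             ≡⟨ cong (length ∘ filter (_<? y)) (range-++ 0 y d) ⟨
  length (filter (_<? y) (range 0 y ++ range y d))      ≡⟨ cong length (filter-interleave-< [] (All.map proj₂ (range-bounds 0 y)) (All.map proj₁ (range-bounds y d))) ⟩
  length (range 0 y)                                    ≡⟨ length-range 0 y ⟩
  y                                                     ∎
  where open ≡-Reasoning

-- Counting: exactly y entries are below y, and the front part has length y. An entry of at least y
-- in front would force everything behind to be at least y too, leaving fewer than y places for the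
-- small entries.
sortedAt-sides : ∀ y d {xs} → xs ↭ range 0 (y + d) → SortedAt _≤_ y xs →
  All (_< y) (List.take y xs) × All (y ≤_) (List.drop y xs)
sortedAt-sides y d {xs} perm sorted = L<y , R≥y
  where
  open ≤-Reasoning
  L = List.take y xs
  R = List.drop y xs
  # : List ℕ → ℕ
  # = length ∘ filter (_<? y)
  #-total : # L + # R ≡ y
  #-total = begin-equality
    # L + # R             ≡⟨ List.length-++ (filter (_<? y) L) ⟨
    length (filter (_<? y) L ++ filter (_<? y) R) ≡⟨ cong length (List.filter-++ (_<? y) L R) ⟨
    # (L ++ R)            ≡⟨ cong # (List.take++drop≡id y xs) ⟩
    # xs                  ≡⟨ ↭-length (filter-↭ (_<? y) perm) ⟩
    # (range 0 (y + d))   ≡⟨ length-filter-range y d ⟩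
    y                     ∎
  length-L : length L ≡ y
  length-L = begin-equality
    length L                  ≡⟨ List.length-take y xs ⟩
    y ⊓ length xs             ≡⟨ cong (y ⊓_) (trans (↭-length perm) (length-range 0 (y + d))) ⟩
    y ⊓ (y + d)               ≡⟨ m≤n⇒m⊓n≡m (m≤m+n y d) ⟩
    y                         ∎
  L<y : All (_< y) L
  L<y = All.tabulate λ {a} a∈L → ≰⇒> λ y≤a → <-irrefl refl (begin-strict
    y           ≡⟨ #-total ⟨
    # L + # R   ≡⟨ cong (# L +_) (cong length (List.filter-none (_<? y)
                     (All.map (λ a≤b → ≤⇒≯ (≤-trans y≤a a≤b)) (All.lookup sorted a∈L)))) ⟩
    # L + 0     ≡⟨ +-identityʳ (# L) ⟩
    # L         <⟨ List.filter-notAll (_<? y) L (lose a∈L (≤⇒≯ y≤a)) ⟩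
    length L    ≡⟨ length-L ⟩
    y           ∎)
  R≥y : All (y ≤_) R
  R≥y = All.tabulate λ {b} b∈R → ≮⇒≥ λ b<y → <-irrefl refl (begin-strict
    y           ≡⟨ length-L ⟨
    length L    ≡⟨ cong length (List.filter-all (_<? y) L<y) ⟨
    # L         <⟨ m<m+n (# L) (List.filter-some (_<? y) (lose b∈R b<y)) ⟩
    # L + # R   ≡⟨ #-total ⟩
    y           ∎)

-- Pivots as separators of every LOHified output

module _ {p : ℕ → ℕ} (increasing : ∀ i → p i < p (suc i)) where

  p-mono : ∀ i d → p i ≤ p (i + d)
  p-mono i zero    = ≤-reflexive (cong p (sym (+-identityʳ i)))
  p-mono i (suc d) = ≤-trans (p-mono i d) (≤-trans (<⇒≤ (increasing (i + d))) (≤-reflexive (cong p (sym (+-suc i d)))))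

  i≤p[i] : ∀ i → i ≤ p i
  i≤p[i] zero    = z≤n
  i≤p[i] (suc i) = ≤-<-trans (i≤p[i] i) (increasing i)

  findLayer : ∀ {n} i (k : Fin n) → toℕ k < p i → ∃[ j ] j ≤ i × InLayer p j k
  findLayer zero    k k<p = 0 , z≤n , z≤n , k<p
  findLayer (suc i) k k<p with p i ≤? toℕ k
  ... | yes p≤k = suc i , ≤-refl , p≤k , k<p
  ... | no  p≰k with j , j≤i , layer ← findLayer i k (≰⇒> p≰k) = j , m≤n⇒m≤1+n j≤i , layer

  module _ {n} (I : Input n) (t : Algorithm n) (loh : LOHifies p t) where

    open DecTotalOrder (Input.order I) using () renaming (_≤_ to _⊑_; trans to ⊑-trans)

    -- `LOHifies` orders adjacent layers only, so distant ones are linked through the first element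
    -- of each layer between, at index p j. That layer is nonempty since the pivots increase, and it
    -- begins before the end of the array since l lies in a later one.
    layers-sorted : ∀ d {j} k l → InLayer p j k → InLayer p (suc j + d) l → outputValue I t k ⊑ outputValue I t l
    layers-sorted zero {j} k l kj lj =
      proj₂ (loh I) j k l kj (subst (λ z → InLayer p (suc z) l) (+-identityʳ j) lj)
    layers-sorted (suc d) {j} k l kj lj = ⊑-trans
      (proj₂ (loh I) j k mid kj (≤-reflexive (sym mid≡) , subst (_< p (suc j)) (sym mid≡) (increasing j)))
      (layers-sorted d mid l (≤-reflexive (sym mid≡) , subst (_< p (suc j)) (sym mid≡) (increasing j))
        (subst (λ z → InLayer p (suc z) l) (+-suc j d) lj))
      where
      p[j]<n : p j < n
      p[j]<n = ≤-<-trans (p-mono j (suc d)) (≤-<-trans (proj₁ lj) (Fin.toℕ<n l))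
      mid = fromℕ< p[j]<n
      mid≡ = Fin.toℕ-fromℕ< p[j]<n

    pivots-separate : ∀ i k l → toℕ k < p i → p i ≤ toℕ l → outputValue I t k ⊑ outputValue I t l
    pivots-separate i k l k<p p≤l
      with j , j≤i , kj ← findLayer i k k<p
         -- The search for the layer of l needs some pivot beyond l; pivot number `suc (toℕ l)` is
         -- one because p grows by at least 1 each time.
         | j′ , _ , lj ← findLayer (suc (toℕ l)) l (i≤p[i] (suc (toℕ l)))
      with d , refl ← m≤n⇒∃[o]m+o≡n {suc j} {j′} (≤-<-trans j≤i (≰⇒> λ j′≤i → case m≤n⇒∃[o]m+o≡n j′≤i of λ where
             (o , refl) → <⇒≱ (proj₂ lj) (≤-trans (p-mono j′ o) p≤l)))
      = layers-sorted d k l kj lj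

toList-tabulate : ∀ {A : Set} {n} (f : Fin n → A) → toList (Vec.tabulate f) ≡ List.tabulate f
toList-tabulate {n = zero}  f = refl
toList-tabulate {n = suc n} f = cong (f zero ∷_) (toList-tabulate (f ∘ suc))

map-lookup-allFin : ∀ {A : Set} {n} (xs : Vec A n) → List.map (lookup xs) (List.allFin n) ≡ toList xs
map-lookup-allFin xs = trans (List.map-tabulate id (lookup xs))
  (trans (sym (toList-tabulate (lookup xs))) (cong toList (Vec.tabulate∘lookup xs)))

rankInput : ∀ {n} (w : Vec ℕ n) → Unique (toList w) → Input n
rankInput w uniq = record { order = ≤-decTotalOrder ; value = lookup w ; distinct = lookup-injective w uniq }

module _ {p : ℕ → ℕ} (increasing : ∀ i → p i < p (suc i))
         {n} (t : Algorithm n) (loh : LOHifies p t) where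

  output-pivot-sides : (w : Vec ℕ n) (uniq : Unique (toList w)) → toList w ↭ range 0 n →
    let o = output (rankInput w uniq) t in
    ∀ y → PivotBetween p 0 n y → ∀ k →
    (toℕ k < y → lookup w (lookup o k) < y) × (y ≤ toℕ k → y ≤ lookup w (lookup o k))
  output-pivot-sides w uniq perm y ((i , refl) , 0<y , y<n) k
    with d , refl ← m≤n⇒∃[o]m+o≡n (<⇒≤ y<n) =
      (λ k<y → subst (_< p i) (Vec.lookup-map k (lookup w) o) (take⁻ f y (proj₁ bounds) k k<y)) ,
      (λ y≤k → subst (p i ≤_) (Vec.lookup-map k (lookup w) o) (drop⁻ f y (proj₂ bounds) k y≤k))
    where
    I = rankInput w uniq
    o = output I t
    f = Vec.map (lookup w) o
    bounds : All (_< p i) (List.take (p i) (toList f)) × All (p i ≤_) (List.drop (p i) (toList f))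
    bounds = sortedAt-sides (p i) d
      (begin
        toList f                                ≡⟨ Vec.toList-map (lookup w) o ⟩
        List.map (lookup w) (toList o)          ↭⟨ map⁺ (lookup w) (proj₁ (loh I)) ⟩
        List.map (lookup w) (List.allFin n)     ≡⟨ map-lookup-allFin w ⟩
        toList w                                ↭⟨ perm ⟩
        range 0 n                               ∎)
      (take⁺ f y λ k k<y → drop⁺ f y λ l y≤l → subst₂ _≤_ (sym (Vec.lookup-map k (lookup w) o)) (sym (Vec.lookup-map l (lookup w) o))
        (pivots-separate increasing I t loh i k l k<y y≤l))
      where open PermutationReasoning

  -- The common output sends an element to one index k for both inputs, and whether k lies before y
  -- decides on which side of y its rank is in either input. The output is a permutation, so this
  -- reaches every element.
  same-output⇒indistinguishable : (w w′ : Vec ℕ n) (uniq : Unique (toList w)) (uniq′ : Unique (toList w′)) →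
    toList w ↭ range 0 n → toList w′ ↭ range 0 n →
    output (rankInput w uniq) t ≡ output (rankInput w′ uniq′) t →
    Indistinguishable {p} 0 n (toList w) (toList w′)
  same-output⇒indistinguishable w w′ uniq uniq′ perm perm′ eq = lookup-pointwise w w′ λ e y py →
    All.lookup {P = λ e → SameSide y (lookup w e) (lookup w′ e)}
      (All-resp-↭ (proj₁ (loh (rankInput w uniq))) (drop⁺ o 0 λ k _ → atPosition y py k)) (∈-allFin e)
    where
    o = output (rankInput w uniq) t
    atPosition : ∀ y → PivotBetween p 0 n y → ∀ k → SameSide y (lookup w (lookup o k)) (lookup w′ (lookup o k))
    atPosition y py k with s ← output-pivot-sides w uniq perm y py k
                         | s′ ← output-pivot-sides w′ uniq′ perm′ y py k
      rewrite sym eq =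
        (λ lt → proj₁ s′ (≰⇒> λ y≤k → <⇒≱ lt (proj₂ s y≤k))) ,
        (λ lt → proj₁ s (≰⇒> λ y≤k → <⇒≱ lt (proj₂ s′ y≤k)))

  module _ (T : SplitTree p 0 n) where

    private
      length-word : ∀ bs → length (word T bs) ≡ n
      length-word bs = trans (↭-length (word-↭ T bs)) (length-range 0 n)

      wordVec : Vec Bool (swaps T) → Vec ℕ n
      wordVec bs = Vec.cast (length-word bs) (Vec.fromList (word T bs))

      toList-wordVec : ∀ bs → toList (wordVec bs) ≡ word T bs
      toList-wordVec bs = trans (Vec.toList-cast (length-word bs) (Vec.fromList (word T bs))) (Vec.toList∘fromList (word T bs))

      wordVec-↭ : ∀ bs → toList (wordVec bs) ↭ range 0 n
      wordVec-↭ bs = ↭-trans (↭-reflexive (toList-wordVec bs)) (word-↭ T bs)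

      wordVec-unique : ∀ bs → Unique (toList (wordVec bs))
      wordVec-unique bs = Unique-resp-↭ (↭-sym (wordVec-↭ bs)) (range-unique 0 n)

      wordInput : Vec Bool (swaps T) → Input n
      wordInput bs = rankInput (wordVec bs) (wordVec-unique bs)

    swaps≤runtime : ∀ {B} → RunsWithin t B → n + swaps T ≤ B
    -- Any single input shows n ≤ B; the word with all bits true serves. Then d = B - n bounds the
    -- cost on every input.
    swaps≤runtime {B} runs with d , refl ← m≤n⇒∃[o]m+o≡n (m+n≤o⇒m≤o n (runs (wordInput (Vec.replicate (swaps T) true)))) =
      +-monoʳ-≤ n (bits≤cost (Input.answer ∘ wordInput) t
        (λ {bs} {bs′} eq → word-injective T bs bs′
          (subst₂ (Indistinguishable 0 n) (toList-wordVec bs) (toList-wordVec bs′)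
            (same-output⇒indistinguishable (wordVec bs) (wordVec bs′) (wordVec-unique bs) (wordVec-unique bs′) (wordVec-↭ bs) (wordVec-↭ bs′) eq)))
        (λ bs → +-cancelˡ-≤ n _ _ (runs (wordInput bs))))

-- The partitioning algorithm

module _ {X : Set} (ans : X → X → Bool) where

  private variable
    R S Y : Set

  result->>= : (t : Comp X R) (f : R → Comp X S) → result ans (t >>= f) ≡ result ans (f (result ans t))
  result->>= (return r)      f = refl
  result->>= (step t)        f = result->>= t f
  result->>= (compare x y k) f = result->>= (k (ans x y)) f

  cost->>= : (t : Comp X R) (f : R → Comp X S) → cost ans (t >>= f) ≡ cost ans t + cost ans (f (result ans t))
  cost->>= (return r)      f = refl
  cost->>= (step t)        f = cong suc (cost->>= t f)
  cost->>= (compare x y k) f = cong suc (cost->>= (k (ans x y)) f)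

  result-rename : (h : Y → X) (t : Comp Y R) → result ans (rename h t) ≡ result (λ i j → ans (h i) (h j)) t
  result-rename h (return r)      = refl
  result-rename h (step t)        = result-rename h t
  result-rename h (compare x y k) = result-rename h (k (ans (h x) (h y)))

  cost-rename : (h : Y → X) (t : Comp Y R) → cost ans (rename h t) ≡ cost (λ i j → ans (h i) (h j)) t
  cost-rename h (return r)      = refl
  cost-rename h (step t)        = cong suc (cost-rename h t)
  cost-rename h (compare x y k) = cong suc (cost-rename h (k (ans (h x) (h y))))

  result-steps : ∀ k (t : Comp X R) → result ans (steps k t) ≡ result ans t
  result-steps zero    t = refl
  result-steps (suc k) t = result-steps k t

  cost-steps : ∀ k (t : Comp X R) → cost ans (steps k t) ≡ k + cost ans t
  cost-steps zero    t = refl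
  cost-steps (suc k) t = cong suc (cost-steps k t)

module _ {A : Set} where

  take-++ : (as : List A) {bs : List A} → List.take (length as) (as ++ bs) ≡ as
  take-++ []       = refl
  take-++ (a ∷ as) = cong (a ∷_) (take-++ as)

  drop-++ : ∀ (as : List A) c {bs : List A} → List.drop (length as + c) (as ++ bs) ≡ List.drop c bs
  drop-++ []       c = refl
  drop-++ (a ∷ as) c = drop-++ as c

module _ {A : Set} {_≤′_ : A → A → Set} where

  sortedAt-++ˡ : ∀ c as {bs : List A} → c ≤ length as → SortedAt _≤′_ c as →
    All (λ a → All (a ≤′_) bs) as → SortedAt _≤′_ c (as ++ bs)
  sortedAt-++ˡ c as {bs} c≤ sorted cross = subst₂ (λ xs ys → All (λ a → All (a ≤′_) ys) xs)
    (sym (take-++ˡ c as c≤)) (sym (drop-++ˡ c as c≤))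
    (All.zipWith (λ (h₁ , h₂) → All.++⁺ h₁ h₂) (sorted , All.take⁺ c cross))
    where
    take-++ˡ : ∀ c as → c ≤ length as → List.take c (as ++ bs) ≡ List.take c as
    take-++ˡ zero    as       _         = refl
    take-++ˡ (suc c) (a ∷ as) (s≤s c≤) = cong (a ∷_) (take-++ˡ c as c≤)
    drop-++ˡ : ∀ c as → c ≤ length as → List.drop c (as ++ bs) ≡ List.drop c as ++ bs
    drop-++ˡ zero    as       _         = refl
    drop-++ˡ (suc c) (a ∷ as) (s≤s c≤) = drop-++ˡ c as c≤

  sortedAt-++ʳ : ∀ c as {bs : List A} → SortedAt _≤′_ c bs →
    All (λ a → All (a ≤′_) bs) as → SortedAt _≤′_ (length as + c) (as ++ bs)
  sortedAt-++ʳ c []       sorted []            = sorted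
  sortedAt-++ʳ c (a ∷ as) sorted (a≤ ∷ cross) =
    subst (All (a ≤′_)) (sym (drop-++ as c)) (All.drop⁺ c a≤) ∷ sortedAt-++ʳ c as sorted cross

  -- A cut y lies left of x, at x, or right of it. Comparisons inside one part come from that part,
  -- and all others pass through e by transitivity; Q singles out the pivots.
  sortedAt-join : (∀ {a b c} → a ≤′ b → b ≤′ c → a ≤′ c) → ∀ (Q : ℕ → Set) {x} s {as e bs} →
    x ≡ s + length as → All (_≤′ e) as → All (e ≤′_) bs →
    (∀ y → Q y → s < y → y < x → SortedAt _≤′_ (y ∸ s) as) →
    (∀ y → Q y → suc x < y → y < suc x + length bs → SortedAt _≤′_ (y ∸ suc x) bs) →
    ∀ y → Q y → s < y → y < suc x + length bs → SortedAt _≤′_ (y ∸ s) (as ++ e ∷ bs)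
  sortedAt-join ≤′-trans Q {x} s {as} {e} {bs} refl as≤e e≤bs sortedˡ sortedʳ y qy s<y y< with <-cmp y x
  ... | tri< y<x _ _ = sortedAt-++ˡ (y ∸ s) as
    (≤-trans (∸-monoˡ-≤ s (<⇒≤ y<x)) (≤-reflexive (m+n∸m≡n s (length as))))
    (sortedˡ y qy s<y y<x) (All.map (λ a≤e → a≤e ∷ All.map (≤′-trans a≤e) e≤bs) as≤e)
  ... | tri≈ _ refl _ rewrite m+n∸m≡n s (length as) = subst (λ c → SortedAt _≤′_ c (as ++ e ∷ bs)) (+-identityʳ (length as))
    (sortedAt-++ʳ 0 as [] (All.map (λ a≤e → a≤e ∷ All.map (≤′-trans a≤e) e≤bs) as≤e))
  ... | tri> _ _ x<y with d , refl ← m≤n⇒∃[o]m+o≡n x<y =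
    subst₂ (SortedAt _≤′_) index (List.++-assoc as List.[ e ] bs)
      (sortedAt-++ʳ d (as ++ List.[ e ]) (right d qy y< sortedʳ)
        (All.++⁺ (All.map (λ a≤e → All.map (≤′-trans a≤e) e≤bs) as≤e) (e≤bs ∷ [])))
    where
    index : length (as ++ List.[ e ]) + d ≡ suc (s + length as) + d ∸ s
    index = sym (begin
      suc (s + length as) + d ∸ s      ≡⟨ cong (λ z → z + d ∸ s) (+-suc s (length as)) ⟨
      s + suc (length as) + d ∸ s      ≡⟨ cong (_∸ s) (+-assoc s (suc (length as)) d) ⟩
      s + (suc (length as) + d) ∸ s    ≡⟨ m+n∸m≡n s (suc (length as) + d) ⟩
      suc (length as) + d              ≡⟨ cong (_+ d) (trans (List.length-++ as) (+-comm (length as) 1)) ⟨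
      length (as ++ List.[ e ]) + d    ∎)
      where open ≡-Reasoning
    right : ∀ d → Q (suc x + d) → suc x + d < suc x + length bs →
      (∀ y → Q y → suc x < y → y < suc x + length bs → SortedAt _≤′_ (y ∸ suc x) bs) → SortedAt _≤′_ d bs
    -- A pivot equal to `suc x` lies strictly inside neither part. The cut directly after e then
    -- follows from the comparisons with e alone.
    right zero    _ _  _ = []
    right (suc d) q y< h = subst (λ c → SortedAt _≤′_ c bs) (m+n∸m≡n (suc x) (suc d)) (h (suc x + suc d) q (m<m+n (suc x) z<s) y<)

lookup-∷ʳ-++ : ∀ {A : Set} {k j} (as : Vec A k) {e} {bs : Vec A j} (i : Fin (suc k + j)) → toℕ i ≡ k →
  lookup ((as ∷ʳ e) Vec.++ bs) i ≡ e
lookup-∷ʳ-++ []       zero    _  = refl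
lookup-∷ʳ-++ (_ ∷ as) (suc i) eq = lookup-∷ʳ-++ as i (suc-injective eq)

toList-∷ʳ-++ : ∀ {A : Set} {k j} (as : Vec A k) e (bs : Vec A j) →
  toList ((as ∷ʳ e) Vec.++ bs) ≡ toList as ++ e ∷ toList bs
toList-∷ʳ-++ []       e bs = refl
toList-∷ʳ-++ (a ∷ as) e bs = cong (a ∷_) (toList-∷ʳ-++ as e bs)

-- `Selects` speaks of inputs with distinct values, so a subarray must itself become one. Hence
-- uniqueness of the handles accompanies every segment below.
restrict : ∀ {n m} (I : Input n) (xs : Vec (Fin n) m) → Unique (toList xs) → Input m
restrict I xs uniq = record
  { order    = Input.order I
  ; value    = Input.value I ∘ lookup xs
  ; distinct = lookup-injective xs uniq ∘ Input.distinct I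
  }

module _ {p : ℕ → ℕ} (rule : CenterRule p) (sel : LinearSelection) where
  open LinearSelection sel

  module _ {n} (I : Input n) where
    open Input I using (answer; value; order) renaming (_≤_ to _⊑_)

    _≼_ : Fin n → Fin n → Set
    i ≼ j = value i ⊑ value j

    ≼-trans : ∀ {i j k} → i ≼ j → j ≼ k → i ≼ k
    ≼-trans = DecTotalOrder.trans order

    record Partitions s {m} (T : SplitTree p s m) (xs : Vec (Fin n) m) (t : Comp (Fin n) (Vec (Fin n) m)) : Set where
      field
        permutes  : toList (result answer t) ↭ toList xs
        separates : ∀ y → PivotBetween p s (s + m) y → SortedAt _≼_ (y ∸ s) (toList (result answer t))
        cost≤     : cost answer t ≤ constant * totalSize T

    open Partitions

    module Selected {k j} (xs : Vec (Fin n) (suc k + j)) (uniq : Unique (toList xs))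
                    (i : Fin (suc k + j)) (i≡k : toℕ i ≡ k) where

      private
        I′ = restrict I xs uniq
        chosen = output I′ (select (suc k + j) i)

      ys = Vec.map (lookup xs) chosen
      as = Vec.init (Vec.take (suc k) ys)
      e  = Vec.last (Vec.take (suc k) ys)
      bs = Vec.drop (suc k) ys

      result-selectIn : result answer (selectIn rule sel i xs) ≡ ys
      result-selectIn = trans (result->>= answer (rename (lookup xs) (select _ i)) _)
        (cong (Vec.map (lookup xs)) (result-rename answer (lookup xs) (select _ i)))

      cost-selectIn : cost answer (selectIn rule sel i xs) ≤ constant * (suc k + j)
      cost-selectIn = begin
        cost answer (selectIn rule sel i xs)   ≡⟨ cost->>= answer (rename (lookup xs) (select _ i)) _ ⟩
        cost answer (rename (lookup xs) (select _ i)) + 0 ≡⟨ +-identityʳ _ ⟩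
        cost answer (rename (lookup xs) (select _ i)) ≡⟨ cost-rename answer (lookup xs) (select _ i) ⟩
        cost (Input.answer I′) (select _ i)     ≤⟨ m≤n+m _ (suc k + j) ⟩
        suc k + j + cost (Input.answer I′) (select _ i) ≤⟨ linear _ i I′ ⟩
        constant * (suc k + j) ∎
        where open ≤-Reasoning

      ys≡ : ys ≡ (as ∷ʳ e) Vec.++ bs
      ys≡ = trans (sym (Vec.take++drop≡id (suc k) ys)) (cong (Vec._++ bs) (proj₂ (proj₂ (Vec.initLast (Vec.take (suc k) ys)))))

      toList-ys : toList ys ≡ toList as ++ e ∷ toList bs
      toList-ys = trans (cong toList ys≡) (toList-∷ʳ-++ as e bs)

      ys↭xs : toList as ++ e ∷ toList bs ↭ toList xs
      ys↭xs = begin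
        toList as ++ e ∷ toList bs              ≡⟨ toList-ys ⟨
        toList ys                                    ≡⟨ Vec.toList-map (lookup xs) chosen ⟩
        List.map (lookup xs) (toList chosen)         ↭⟨ map⁺ (lookup xs) (proj₁ (selects _ i I′)) ⟩
        List.map (lookup xs) (List.allFin (suc k + j)) ≡⟨ map-lookup-allFin xs ⟩
        toList xs                                    ∎
        where open PermutationReasoning

      private
        length-as : length (toList as) ≡ k
        length-as = Vec.length-toList as

        uniq-ys : Unique (toList as ++ e ∷ toList bs)
        uniq-ys = Unique-resp-↭ (↭-sym ys↭xs) uniq

        take-ys : List.take k (toList as ++ e ∷ toList bs) ≡ toList as
        take-ys = trans (cong (λ c → List.take c (toList as ++ e ∷ toList bs)) (sym length-as)) (take-++ (toList as))

        drop-ys : List.drop (suc k) (toList as ++ e ∷ toList bs) ≡ toList bs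
        drop-ys = trans (cong (λ c → List.drop c (toList as ++ e ∷ toList bs))
          (trans (+-comm 1 k) (cong (_+ 1) (sym length-as)))) (drop-++ (toList as) 1)

        lookup-ys : lookup ys i ≡ e
        lookup-ys = trans (cong (λ ys → lookup ys i) ys≡) (lookup-∷ʳ-++ as i i≡k)

      uniq-as : Unique (toList as)
      uniq-as = subst Unique take-ys (Unique.take⁺ k uniq-ys)

      uniq-bs : Unique (toList bs)
      uniq-bs = subst Unique drop-ys (Unique.drop⁺ (suc k) uniq-ys)

      value-ys : ∀ l → outputValue I′ (select _ i) l ≡ value (lookup ys l)
      value-ys l = cong value (sym (Vec.lookup-map l (lookup xs) chosen))

      as≤e : All (_≼ e) (toList as)
      as≤e = subst (All (_≼ e)) take-ys (subst (λ l → All (_≼ e) (List.take k l)) toList-ys (take⁺ ys k λ l l<k →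
        subst (λ z → lookup ys l ≼ z) lookup-ys (subst₂ _⊑_ (value-ys l) (value-ys i)
          (proj₁ (proj₂ (selects _ i I′)) l (subst (toℕ l <_) (sym i≡k) l<k)))))

      e≤bs : All (e ≼_) (toList bs)
      e≤bs = subst (All (e ≼_)) drop-ys (subst (λ l → All (e ≼_) (List.drop (suc k) l)) toList-ys (drop⁺ ys (suc k) λ l k<l →
        subst (λ z → z ≼ lookup ys l) lookup-ys (subst₂ _⊑_ (value-ys i) (value-ys l)
          (proj₂ (proj₂ (selects _ i I′)) l (subst (_< toℕ l) (sym i≡k) k<l)))))

    -- The recursive calls enter as arbitrary computations meeting their specification, which
    -- separates a single split from the well-founded recursion. Here e = 0: the left part reaches
    -- up to x.
    node-partitions : ∀ {s k j x} {Tˡ : SplitTree p s k} {Tʳ : SplitTree p (suc x) j} {x≡ m≡ closest}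
      (left : Vec (Fin n) k → Comp (Fin n) (Vec (Fin n) k)) (right : Vec (Fin n) j → Comp (Fin n) (Vec (Fin n) j)) →
      (∀ xs → Unique (toList xs) → Partitions s Tˡ xs (left xs)) →
      (∀ xs → Unique (toList xs) → Partitions (suc x) Tʳ xs (right xs)) →
      (i : Fin (suc k + j)) → toℕ i ≡ k →
      ∀ xs → Unique (toList xs) → Partitions s (node k 0 j x x≡ m≡ closest Tˡ Tʳ) xs
        (selectIn rule sel i xs >>= λ ys →
         left (Vec.init (Vec.take (suc k) ys)) >>= λ ls →
         right (Vec.drop (suc k) ys) >>= λ rs →
         return ((ls ∷ʳ Vec.last (Vec.take (suc k) ys)) Vec.++ rs))
    node-partitions {s} {k} {j} {x} {Tˡ} {Tʳ} {x≡} left right leftOK rightOK i i≡k xs uniq = record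
      { permutes = subst (λ zs → toList zs ↭ toList xs) (sym result≡) joined-permutes
      ; separates = λ y (py , s<y , y<) → subst (λ zs → SortedAt _≼_ (y ∸ s) (toList zs)) (sym result≡)
          (subst (SortedAt _≼_ (y ∸ s)) (sym (toList-∷ʳ-++ ls e rs))
            (sortedAt-join ≼-trans (λ y → ∃[ i ] p i ≡ y) s x≡s+
              (All-resp-↭ (↭-sym (permutes lOK)) as≤e) (All-resp-↭ (↭-sym (permutes rOK)) e≤bs)
              (λ y py s<y y<x → separates lOK y (py , s<y , <-≤-trans y<x (≤-reflexive x≡s+k)))
              (λ y py x<y y< → separates rOK y (py , x<y , <-≤-trans y< (≤-reflexive (cong (suc x +_) (Vec.length-toList rs)))))
              y py s<y (<-≤-trans y< (≤-reflexive s+m≡))))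
      ; cost≤ = joined-cost
      }
      where
      open Selected xs uniq i i≡k
      lOK = leftOK as uniq-as
      rOK = rightOK bs uniq-bs
      ls = result answer (left as)
      rs = result answer (right bs)
      body : Vec (Fin n) (suc k + j) → Comp (Fin n) (Vec (Fin n) (suc k + j))
      body ys = left (Vec.init (Vec.take (suc k) ys)) >>= λ ls →
                right (Vec.drop (suc k) ys) >>= λ rs →
                return ((ls ∷ʳ Vec.last (Vec.take (suc k) ys)) Vec.++ rs)
      chosen = selectIn rule sel i xs
      x≡s+k : x ≡ s + k
      x≡s+k = trans x≡ (cong (s +_) (+-identityʳ k))
      x≡s+ : x ≡ s + length (toList ls)
      x≡s+ = trans x≡s+k (cong (s +_) (sym (Vec.length-toList ls)))
      s+m≡ : s + (suc k + j) ≡ suc x + length (toList rs)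
      s+m≡ = begin
        s + (suc k + j)                 ≡⟨ +-assoc s (suc k) j ⟨
        s + suc k + j                   ≡⟨ cong (_+ j) (trans (+-suc s k) (cong suc (sym x≡s+k))) ⟩
        suc x + j                       ≡⟨ cong (suc x +_) (Vec.length-toList rs) ⟨
        suc x + length (toList rs)      ∎
        where open ≡-Reasoning
      result≡ : result answer (chosen >>= body) ≡ (ls ∷ʳ e) Vec.++ rs
      result≡ = begin
        result answer (chosen >>= body)             ≡⟨ result->>= answer chosen body ⟩
        result answer (body (result answer chosen)) ≡⟨ cong (result answer ∘ body) result-selectIn ⟩
        result answer (body ys)                     ≡⟨ result->>= answer (left as) _ ⟩
        result answer (right bs >>= λ rs → return ((ls ∷ʳ e) Vec.++ rs)) ≡⟨ result->>= answer (right bs) _ ⟩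
        (ls ∷ʳ e) Vec.++ rs                             ∎
        where open ≡-Reasoning
      joined-permutes : toList ((ls ∷ʳ e) Vec.++ rs) ↭ toList xs
      joined-permutes = begin
        toList ((ls ∷ʳ e) Vec.++ rs)                 ≡⟨ toList-∷ʳ-++ ls e rs ⟩
        toList ls ++ e ∷ toList rs          ↭⟨ ++⁺ (permutes lOK) (prep e (permutes rOK)) ⟩
        toList as ++ e ∷ toList bs          ↭⟨ ys↭xs ⟩
        toList xs                                ∎
        where open PermutationReasoning
      joined-cost : cost answer (chosen >>= body) ≤ constant * (suc k + j + (totalSize Tˡ + totalSize Tʳ))
      joined-cost = begin
        cost answer (chosen >>= body)
          ≡⟨ cost->>= answer chosen body ⟩
        cost answer chosen + cost answer (body (result answer chosen))
          ≡⟨ cong (λ ys → cost answer chosen + cost answer (body ys)) result-selectIn ⟩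
        cost answer chosen + cost answer (body ys)
          ≡⟨ cong (cost answer chosen +_) (trans (cost->>= answer (left as) _)
               (cong (cost answer (left as) +_) (trans (cost->>= answer (right bs) _) (+-identityʳ _)))) ⟩
        cost answer chosen + (cost answer (left as) + cost answer (right bs))
          ≤⟨ +-mono-≤ cost-selectIn (+-mono-≤ (cost≤ lOK) (cost≤ rOK)) ⟩
        constant * (suc k + j) + (constant * totalSize Tˡ + constant * totalSize Tʳ)
          ≡⟨ cong (constant * (suc k + j) +_) (*-distribˡ-+ constant (totalSize Tˡ) (totalSize Tʳ)) ⟨
        constant * (suc k + j) + constant * (totalSize Tˡ + totalSize Tʳ)
          ≡⟨ *-distribˡ-+ constant (suc k + j) (totalSize Tˡ + totalSize Tʳ) ⟨
        constant * (suc k + j + (totalSize Tˡ + totalSize Tʳ)) ∎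
        where open ≤-Reasoning

  -- The tree is fixed before the input, as split positions depend only on `rule` and the segment.
  -- One tree therefore bounds the cost on all inputs.
  partition-partitions : ∀ s m (ac : Acc _<_ m) → Σ (SplitTree p s m) λ T →
    ∀ {n} (I : Input n) (xs : Vec (Fin n) m) → Unique (toList xs) →
    Partitions I s T xs (partition rule sel s xs ac)
  partition-partitions s m (acc rec) with rule s (s + m)
  ... | inj₂ none = leaf , λ I xs uniq → record
    { permutes = ↭-refl
    ; separates = λ y between → contradiction between (none y)
    ; cost≤ = z≤n
    }
  ... | inj₁ (x , c@(_ , s<x , x<s+m) , least)
    with k<m ← subst (x ∸ s <_) (m+n∸m≡n s m) (∸-monoˡ-< x<s+m (<⇒≤ s<x))
    with j , refl ← m≤n⇒∃[o]m+o≡n k<m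
    with Tˡ , leftOK ← partition-partitions s (x ∸ s) (rec k<m)
       | Tʳ , rightOK ← partition-partitions (suc x) j (rec (m<n+m j z<s)) =
    node (x ∸ s) 0 j x
      (trans (sym (m+[n∸m]≡n (<⇒≤ s<x))) (cong (s +_) (sym (+-identityʳ (x ∸ s)))))
      (trans (sym (+-suc (x ∸ s) j)) (cong (_+ suc j) (sym (+-identityʳ (x ∸ s)))))
      (c , least) Tˡ Tʳ ,
    λ I xs uniq → node-partitions I
      (λ xs → partition rule sel s xs (rec k<m)) (λ xs → partition rule sel (suc x) xs (rec (m<n+m j z<s)))
      (leftOK I) (rightOK I) (fromℕ< k<m) (Fin.toℕ-fromℕ< k<m) xs uniq

-- Here e = 1. The pivot exceeds s and so is some `suc x`; the left segment of the recurrence ends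
-- before x, and index x falls into neither part.
recurrence-tree : ∀ {p} (rule : CenterRule p) s t (ac : Acc _<_ (t ∸ s)) → s ≤ t →
  Σ (SplitTree p s (t ∸ s)) λ T → totalSize T ≡ recurrence rule s t ac
recurrence-tree {p} rule s t (acc rec) s≤t with rule s t
... | inj₂ _ = leaf , refl
... | inj₁ (suc x , c@((_ , s<x , x<t) , _))
  with Tˡ , eqˡ ← recurrence-tree rule s x (rec _) (s≤s⁻¹ s<x)
     | Tʳ , eqʳ ← recurrence-tree rule (suc (suc x)) t (rec _) x<t =
  node (x ∸ s) 1 (t ∸ suc (suc x)) (suc x) x≡ t∸s≡
    (subst (λ z → ClosestPivot p s z (suc x)) (sym (m+[n∸m]≡n s≤t)) c) Tˡ Tʳ ,
  trans (cong (t ∸ s +_) (cong₂ _+_ eqˡ eqʳ)) (sym (+-assoc (t ∸ s) _ _))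
  where
  open ≡-Reasoning
  x≡ : suc x ≡ s + (x ∸ s + 1)
  x≡ = begin
    suc x              ≡⟨ +-comm 1 x ⟩
    x + 1              ≡⟨ cong (_+ 1) (m+[n∸m]≡n (s≤s⁻¹ s<x)) ⟨
    s + (x ∸ s) + 1    ≡⟨ +-assoc s (x ∸ s) 1 ⟩
    s + (x ∸ s + 1)    ∎
  t∸s≡ : t ∸ s ≡ x ∸ s + 1 + suc (t ∸ suc (suc x))
  t∸s≡ = +-cancelˡ-≡ s _ _ (begin
    s + (t ∸ s)                                   ≡⟨ m+[n∸m]≡n s≤t ⟩
    t                                             ≡⟨ m+[n∸m]≡n x<t ⟨
    suc (suc x) + (t ∸ suc (suc x))               ≡⟨ +-suc (suc x) (t ∸ suc (suc x)) ⟨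
    suc x + suc (t ∸ suc (suc x))                 ≡⟨ cong (_+ suc (t ∸ suc (suc x))) x≡ ⟩
    s + (x ∸ s + 1) + suc (t ∸ suc (suc x))       ≡⟨ +-assoc s (x ∸ s + 1) _ ⟩
    s + (x ∸ s + 1 + suc (t ∸ suc (suc x)))       ∎)

-- Comparison with an arbitrary LOHification

module _ {p : ℕ → ℕ} (increasing : ∀ i → p i < p (suc i)) {n} (t : Algorithm n) (loh : LOHifies p t) where

  totalSize≤2*runtime : ∀ (T : SplitTree p 0 n) {B} → RunsWithin t B → totalSize T ≤ 2 * B
  totalSize≤2*runtime T {B} runs = begin
    totalSize T              ≤⟨ totalSize≤ T ⟩
    2 * swaps T + 2 * n      ≡⟨ *-distribˡ-+ 2 (swaps T) n ⟨
    2 * (swaps T + n)        ≡⟨ cong (2 *_) (+-comm (swaps T) n) ⟩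
    2 * (n + swaps T)        ≤⟨ *-monoʳ-≤ 2 (swaps≤runtime increasing t loh T runs) ⟩
    2 * B                    ∎
    where open ≤-Reasoning

  -- `leaf` is a tree for the whole array, with no swaps.
  length≤runtime : ∀ {B} → RunsWithin t B → n ≤ B
  length≤runtime runs = m+n≤o⇒m≤o n (swaps≤runtime increasing t loh leaf runs)

module _ {p : ℕ → ℕ} (rule : CenterRule p) (sel : LinearSelection) where

  open LinearSelection sel using (constant)

  private
    toList-positions : ∀ n → toList (Vec.allFin n) ≡ List.allFin n
    toList-positions n = toList-tabulate id

    run : ∀ n → Σ (SplitTree p 0 n) λ T → ∀ I →
      Partitions rule sel I 0 T (Vec.allFin n) (partition rule sel 0 (Vec.allFin n) (<-wellFounded n))
    run n with T , ok ← partition-partitions rule sel 0 n (<-wellFounded n) =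
      T , λ I → ok I (Vec.allFin n) (subst Unique (sym (toList-positions n)) (Unique.allFin⁺ n))

  centerTree : ∀ n → SplitTree p 0 n
  centerTree n = proj₁ (run n)

  centerPartitioning-LOHifies : ∀ n → LOHifies p (centerPartitioning rule sel n)
  centerPartitioning-LOHifies n I = permutes′ , λ i k l (_ , k<p) (p≤l , _) → sorted i k l k<p p≤l
    where
    open Partitions (proj₂ (run n) I)
    core = partition rule sel 0 (Vec.allFin n) (<-wellFounded n)
    output≡ : output I (centerPartitioning rule sel n) ≡ output I core
    output≡ = result-steps (Input.answer I) n core
    permutes′ : Rearranges I (centerPartitioning rule sel n)
    permutes′ = ↭-trans (↭-reflexive (cong toList output≡)) (↭-trans permutes (↭-reflexive (toList-positions n)))
    sorted : ∀ i k l → toℕ k < p i → p i ≤ toℕ l → Input._≤_ I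
      (outputValue I (centerPartitioning rule sel n) k) (outputValue I (centerPartitioning rule sel n) l)
    sorted i k l k<p p≤l rewrite output≡ =
      -- k < p i ≤ l < n places the pivot strictly inside the array, as `separates` demands.
      drop⁻ o (p i) (take⁻ o (p i) (separates (p i) ((i , refl) , ≤-<-trans z≤n k<p , ≤-<-trans p≤l (Fin.toℕ<n l))) k k<p) l p≤l
      where o = output I core

  centerPartitioning-runtime : ∀ n → RunsWithin (centerPartitioning rule sel n) (2 * n + constant * totalSize (centerTree n))
  centerPartitioning-runtime n I = begin
    n + cost answer (steps n core)       ≡⟨ cong (n +_) (cost-steps answer n core) ⟩
    n + (n + cost answer core)           ≡⟨ +-assoc n n _ ⟨
    n + n + cost answer core             ≤⟨ +-mono-≤ (≤-reflexive (cong (n +_) (sym (+-identityʳ n)))) cost≤ ⟩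
    2 * n + constant * totalSize (centerTree n) ∎
    where
    open ≤-Reasoning
    open Input I using (answer)
    open Partitions (proj₂ (run n) I) using (cost≤)
    core = partition rule sel 0 (Vec.allFin n) (<-wellFounded n)

theorem2p10 : (α : ℝ) → 1ℝ ≤ℝ α →
    (p : ℕ → ℕ) → ArePivots α p →
    (rule : CenterRule p) →
    ((sel : LinearSelection) → AsymptoticallyOptimal p (centerPartitioning rule sel)) ×
    ((c : ℕ) (T : ℕ → ℕ) → (∀ n → T n ≤ c * (n + r rule 0 n)) → OptimalRuntime p T)
theorem2p10 α 1≤α p pivots rule = optimal , optimalRuntime
  where
  open ≤-Reasoning
  increasing = pivots-increasing α 1≤α p pivots
  optimal : (sel : LinearSelection) → AsymptoticallyOptimal p (centerPartitioning rule sel)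
  -- The first 2 covers reading the input and computing the pivots, n each with n ≤ B; the other is
  -- the factor of `totalSize≤2*runtime`. The bounds hold from n = 0 on.
  optimal sel = centerPartitioning-LOHifies rule sel , 2 + constant * 2 , 0 , λ n _ t loh B runs I → begin
    n + cost (Input.answer I) (centerPartitioning rule sel n)
      ≤⟨ centerPartitioning-runtime rule sel n I ⟩
    2 * n + constant * totalSize (centerTree rule sel n)
      ≤⟨ +-mono-≤ (*-monoʳ-≤ 2 (length≤runtime increasing t loh runs))
           (*-monoʳ-≤ constant (totalSize≤2*runtime increasing t loh (centerTree rule sel n) runs)) ⟩
    2 * B + constant * (2 * B)
      ≡⟨ cong (2 * B +_) (*-assoc constant 2 B) ⟨
    2 * B + constant * 2 * B
      ≡⟨ *-distribʳ-+ B 2 (constant * 2) ⟨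
    (2 + constant * 2) * B ∎
    where open LinearSelection sel using (constant)
  optimalRuntime : (c : ℕ) (T : ℕ → ℕ) → (∀ n → T n ≤ c * (n + r rule 0 n)) → OptimalRuntime p T
  -- 3 = 1 + 2, from n ≤ B and r ≤ 2 B.
  optimalRuntime c T T≤ = c * 3 , 0 , λ n _ t loh B runs →
    let tree , size≡r = recurrence-tree rule 0 n (<-wellFounded n) z≤n in begin
    T n                        ≤⟨ T≤ n ⟩
    c * (n + r rule 0 n)       ≡⟨ cong (λ z → c * (n + z)) size≡r ⟨
    c * (n + totalSize tree)   ≤⟨ *-monoʳ-≤ c (+-mono-≤ (length≤runtime increasing t loh runs) (totalSize≤2*runtime increasing t loh tree runs)) ⟩
    c * (3 * B)                ≡⟨ *-assoc c 3 B ⟨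
    c * 3 * B                  ∎
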